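{- Let $n\geq 1$ be an integer, let $\mathbb{F}_q$ be a finite field with $q$ elements, and let $\mathcal{F}_q\subseteq GL_n(\mathbb{F}_q)$ be an intersecting set. Then $$|\mathcal{F}_q|\leq q^{(n-1)n/2}\prod_{i=1}^{n-1}(q^i-1).$$
   Context: $\mathbb{F}_q^n$ is the $n$-dimensional row vector space over $\mathbb{F}_q$, and $GL_n(\mathbb{F}_q)$ is the group of $n\times n$ nonsingular matrices over $\mathbb{F}_q$, acting on $\mathbb{F}_q^n$ by right multiplication $(\alpha,T)\mapsto \alpha T$. A set $\mathcal{F}_q\subseteq GL_n(\mathbb{F}_q)$ is called intersecting if for any $T,S\in\mathcal{F}_q$ there exists a non-zero vector $\alpha\in\mathbb{F}_q^n$ such that $\alpha T=\alpha S$. (An empty product equals $1$.) -}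

module Defs where

open import Algebra.Bundles using (CommutativeRing)
open import Data.Bool.Base using (if_then_else_)
open import Data.Fin.Base using (Fin)
open import Data.Fin.Properties using (_≟_)
open import Data.Nat.Base using (ℕ)
open import Data.Product.Base using (Σ; ∃-syntax; _×_; proj₁)
open import Data.Vec.Functional using (Vector; replicate)
open import Function.Bundles using (Bijection)
open import Level using (Level; _⊔_)
open import Relation.Binary.Bundles using (Setoid)
import Relation.Binary.Construct.On as On
import Relation.Binary.PropositionalEquality.Properties as ≡
open import Relation.Nullary.Decidable.Core using (does)
open import Relation.Nullary.Negation.Core using (¬_)
open import Relation.Unary using (Pred)

infix 4 _HasCardinality_

_HasCardinality_ : ∀ {a ℓ} → Setoid a ℓ → ℕ → Set (a ⊔ ℓ)
S HasCardinality m = Bijection (≡.setoid (Fin m)) S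

-- The elements of a subset P of a setoid S, compared by the equality of S,
-- so that membership proofs do not affect cardinality.
subset : ∀ {a ℓ p} (S : Setoid a ℓ) → Pred (Setoid.Carrier S) p → Setoid (a ⊔ p) ℓ
subset S P = On.setoid {B = Σ (Setoid.Carrier S) P} S proj₁

module _ {c ℓ : Level} (R : CommutativeRing c ℓ) where
  open CommutativeRing R
  open import Algebra.Definitions _≈_ using (Invertible)

  -- The library's HeytingField asks for a separate apartness relation; over a
  -- finite carrier equality is decidable and plain inequality serves instead.
  record IsField : Set (c ⊔ ℓ) where
    field
      0≉1           : ¬ (0# ≈ 1#)
      ≉0⇒invertible : ∀ x → ¬ (x ≈ 0#) → Invertible 1# _*_ x

module LinearAlgebra {c ℓ : Level} (R : CommutativeRing c ℓ) where
  open CommutativeRing R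
  open import Algebra.Properties.Semiring.Sum semiring using (sum-syntax)
  open import Data.Vec.Functional.Relation.Binary.Equality.Setoid using (≋-setoid)

  vectorSetoid : ℕ → Setoid c ℓ
  vectorSetoid n = ≋-setoid setoid n

  Matrix : ℕ → Set c
  Matrix n = Vector (Vector Carrier n) n

  matrixSetoid : ℕ → Setoid c ℓ
  matrixSetoid n = ≋-setoid (vectorSetoid n) n

  module _ {n : ℕ} where
    open Setoid (vectorSetoid n) public using () renaming (_≈_ to _≈ᵛ_)
    open Setoid (matrixSetoid n) public using () renaming (_≈_ to _≈ᴹ_)

    infixl 7 _*ᵛ_ _*ᴹ_

    0ᵛ : Vector Carrier n
    0ᵛ = replicate n 0#

    1ᴹ : Matrix n
    1ᴹ i j = if does (i ≟ j) then 1# else 0#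

    _*ᵛ_ : Vector Carrier n → Matrix n → Vector Carrier n
    (α *ᵛ T) j = ∑[ i < n ] (α i * T i j)

    _*ᴹ_ : Matrix n → Matrix n → Matrix n
    (T *ᴹ S) i = T i *ᵛ S

  GL : (n : ℕ) → Pred (Matrix n) (c ⊔ ℓ)
  GL n = Invertible 1ᴹ _*ᴹ_
    where open import Algebra.Definitions (_≈ᴹ_ {n}) using (Invertible)

  Intersecting : ∀ {n p} → Pred (Matrix n) p → Set (c ⊔ ℓ ⊔ p)
  Intersecting 𝓕 =
    ∀ {T S} → 𝓕 T → 𝓕 S → ∃[ α ] (¬ (α ≈ᵛ 0ᵛ) × (α *ᵛ T) ≈ᵛ (α *ᵛ S))

{-# OPTIONS --safe #-}
-- Let K be a field extension of F with q^n elements, identified with F^n as a vector space, and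
-- view a matrix as the tuple (r₀ , … , r_{n-1}) of its rows in K. An intersecting set contains at
-- most one nonsingular matrix for each tuple of ratios r_i / r₀: if S has rows r_i z, then
-- αT = αS says y = y z for y = Σ α_i r_i = αT ≠ 0, so z = 1. After deletion of the first
-- coordinates, the ratios r_1 / r₀ , … , r_{n-1} / r₀ of a nonsingular matrix form a nonsingular
-- matrix of size n − 1, so there are at most q^{n-1} |GL_{n-1}| tuples of ratios. Since r₀ and the ratios
-- determine the matrix, |GL_k| ≤ (q^k − 1) q^{k-1} |GL_{k-1}| by the same normalisation.
--
-- For K one needs an irreducible polynomial of degree n. An irreducible factor of X^{q^n} − X
-- has degree n or at most n / 2, and none occurs twice. Without factors of degree n, the degree
-- q^n would be at most the sum of the degrees of all monic polynomials of degree between 1 and n / 2,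
-- which is smaller than q^n. The conclusion m ≤ … is decidable, so the irreducible polynomial may be
-- obtained under a double negation.
module Submission where

open import Defs
open import Algebra.Bundles using (AbelianGroup; CommutativeRing)
open import Data.Empty using (⊥)
open import Data.Fin.Base
  using (Fin; zero; suc; toℕ; inject₁; fromℕ; combine; finToFun; funToFin; punchIn; punchOut)
open import Data.Fin.Permutation using (permutation; _⟨$⟩ʳ_)
import Data.Fin.Properties as Fin
open import Data.List.Base
  using (List; []; _∷_; _++_; _∷ʳ_; map; length; replicate; tabulate; product; upTo)
import Data.List.Properties as List
open import Data.List.Relation.Unary.All using (All; []; _∷_; tail)
import Data.List.Relation.Unary.All.Properties as All
open import Data.List.Relation.Unary.Any using (Any; here; there)
import Data.List.Relation.Unary.Any.Properties as Any
open import Data.Nat.Base as ℕ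
  using (ℕ; zero; suc; z≤n; s≤s; ⌊_/2⌋)
open import Data.Nat.Combinatorics using (_C_; nCn≡1; nCk≡nC[n∸k])
open import Data.Nat.Divisibility using (divides-refl)
open import Data.Nat.DivMod using (m*n/n≡m; +-distrib-/-∣ʳ)
import Data.Nat.ListAction as ListAction
import Data.Nat.ListAction.Properties as ListAction
import Data.Nat.Properties as ℕ
open import Data.Nat.Tactic.RingSolver using (solve-∀)
open import Data.Product.Base using (_×_; _,_; ∃; ∃₂; ∃-syntax; proj₁; proj₂)
open import Data.Sum.Base using (_⊎_; inj₁; inj₂)
open import Data.Vec.Functional using (removeAt)
open import Function.Base using (_∘_)
open import Function.Bundles using (Bijection)
open import Level using (Level; _⊔_)
open import Relation.Binary.Definitions using (Decidable; tri<; tri≈; tri>; _Respects_)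
open import Relation.Binary.PropositionalEquality.Core as ≡ using (_≡_; _≢_)
open import Relation.Binary.PropositionalEquality.Properties using (module ≡-Reasoning)
open import Relation.Binary.Structures using (IsEquivalence)
open import Relation.Nullary.Decidable
  using (Dec; yes; no; map′; dec-true; dec-false; decidable-stable; ¬¬-excluded-middle)
open import Relation.Nullary.Negation using (¬_; contradiction)
open import Relation.Unary using (Pred; _⊆_)

-- Polynomials as coefficient lists, with degree bounds and division.

module Polynomials {c ℓ} (R : CommutativeRing c ℓ) where
  private module R = CommutativeRing R
  open R using (Carrier; 0#; 1#; _≈_)
  open import Algebra.Properties.Ring R.ring using (-0#≈0#)
  open import Relation.Binary.Reasoning.Setoid R.setoid

  Poly : Set c
  Poly = List Carrier

  coef : Poly → ℕ → Carrier
  coef []      _       = 0#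
  coef (a ∷ f) zero    = a
  coef (a ∷ f) (suc i) = coef f i

  infix 4 _≈ₚ_
  -- Trailing zeros are allowed in a list, so equality compares coefficients and never the lists
  -- themselves. The record keeps `f` and `g` recoverable from the type.
  record _≈ₚ_ (f g : Poly) : Set ℓ where
    constructor mk≈
    field at : ∀ i → coef f i ≈ coef g i
  open _≈ₚ_ public

  infixl 6 _+ₚ_
  infixl 7 _*ₚ_
  infixr 8 _·_

  _+ₚ_ : Poly → Poly → Poly
  []      +ₚ g       = g
  (a ∷ f) +ₚ []      = a ∷ f
  (a ∷ f) +ₚ (b ∷ g) = a R.+ b ∷ f +ₚ g

  -ₚ_ : Poly → Poly
  -ₚ_ = map (λ a → R.- a)

  _·_ : Carrier → Poly → Poly
  a · f = map (λ b → a R.* b) f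

  _*ₚ_ : Poly → Poly → Poly
  []      *ₚ g = []
  (a ∷ f) *ₚ g = a · g +ₚ (0# ∷ f *ₚ g)

  coef-+ : ∀ f g i → coef (f +ₚ g) i ≈ coef f i R.+ coef g i
  coef-+ []      g       i       = R.sym (R.+-identityˡ _)
  coef-+ (a ∷ f) []      i       = R.sym (R.+-identityʳ _)
  coef-+ (a ∷ f) (b ∷ g) zero    = R.refl
  coef-+ (a ∷ f) (b ∷ g) (suc i) = coef-+ f g i

  coef-neg : ∀ f i → coef (-ₚ f) i ≈ R.- coef f i
  coef-neg []      i       = R.sym -0#≈0#
  coef-neg (a ∷ f) zero    = R.refl
  coef-neg (a ∷ f) (suc i) = coef-neg f i

  coef-· : ∀ a f i → coef (a · f) i ≈ a R.* coef f i
  coef-· a []      i       = R.sym (R.zeroʳ a)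
  coef-· a (b ∷ f) zero    = R.refl
  coef-· a (b ∷ f) (suc i) = coef-· a f i

  ≈ₚ-isEquivalence : IsEquivalence _≈ₚ_
  ≈ₚ-isEquivalence = record
    { refl  = mk≈ λ _ → R.refl
    ; sym   = λ f≈g → mk≈ λ i → R.sym (at f≈g i)
    ; trans = λ f≈g g≈h → mk≈ λ i → R.trans (at f≈g i) (at g≈h i)
    }

  +ₚ-cong : ∀ {f f′ g g′} → f ≈ₚ f′ → g ≈ₚ g′ → f +ₚ g ≈ₚ f′ +ₚ g′
  +ₚ-cong {f} {f′} {g} {g′} f≈ g≈ = mk≈ λ i → begin
    coef (f +ₚ g) i            ≈⟨ coef-+ f g i ⟩
    coef f i R.+ coef g i      ≈⟨ R.+-cong (at f≈ i) (at g≈ i) ⟩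
    coef f′ i R.+ coef g′ i    ≈⟨ coef-+ f′ g′ i ⟨
    coef (f′ +ₚ g′) i          ∎

  +ₚ-assoc : ∀ f g h → (f +ₚ g) +ₚ h ≈ₚ f +ₚ (g +ₚ h)
  +ₚ-assoc f g h = mk≈ λ i → begin
    coef ((f +ₚ g) +ₚ h) i                    ≈⟨ coef-+ (f +ₚ g) h i ⟩
    coef (f +ₚ g) i R.+ coef h i              ≈⟨ R.+-congʳ (coef-+ f g i) ⟩
    coef f i R.+ coef g i R.+ coef h i        ≈⟨ R.+-assoc _ _ _ ⟩
    coef f i R.+ (coef g i R.+ coef h i)      ≈⟨ R.+-congˡ (coef-+ g h i) ⟨
    coef f i R.+ coef (g +ₚ h) i              ≈⟨ coef-+ f (g +ₚ h) i ⟨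
    coef (f +ₚ (g +ₚ h)) i                    ∎

  +ₚ-comm : ∀ f g → f +ₚ g ≈ₚ g +ₚ f
  +ₚ-comm f g = mk≈ λ i → begin
    coef (f +ₚ g) i          ≈⟨ coef-+ f g i ⟩
    coef f i R.+ coef g i    ≈⟨ R.+-comm _ _ ⟩
    coef g i R.+ coef f i    ≈⟨ coef-+ g f i ⟨
    coef (g +ₚ f) i          ∎

  +ₚ-identityʳ : ∀ f → f +ₚ [] ≈ₚ f
  +ₚ-identityʳ f = mk≈ λ i → R.trans (coef-+ f [] i) (R.+-identityʳ _)

  +ₚ-inverseʳ : ∀ f → f +ₚ -ₚ f ≈ₚ []
  +ₚ-inverseʳ f = mk≈ λ i → begin
    coef (f +ₚ -ₚ f) i              ≈⟨ coef-+ f (-ₚ f) i ⟩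
    coef f i R.+ coef (-ₚ f) i      ≈⟨ R.+-congˡ (coef-neg f i) ⟩
    coef f i R.+ (R.- coef f i)     ≈⟨ R.-‿inverseʳ _ ⟩
    0#                              ∎

  +ₚ-abelianGroup : AbelianGroup c ℓ
  +ₚ-abelianGroup = record
    { Carrier = Poly
    ; _≈_ = _≈ₚ_
    ; _∙_ = _+ₚ_
    ; ε = []
    ; _⁻¹ = -ₚ_
    ; isAbelianGroup = record
      { isGroup = record
        { isMonoid = record
          { isSemigroup = record
            { isMagma = record { isEquivalence = ≈ₚ-isEquivalence ; ∙-cong = +ₚ-cong }
            ; assoc = +ₚ-assoc }
          ; identity = (λ _ → mk≈ λ _ → R.refl) , +ₚ-identityʳ }
        ; inverse = (λ f → trans (+ₚ-comm (-ₚ f) f) (+ₚ-inverseʳ f)) , +ₚ-inverseʳ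
        ; ⁻¹-cong = λ {f} {g} f≈g → mk≈ λ i → begin
            coef (-ₚ f) i   ≈⟨ coef-neg f i ⟩
            R.- coef f i    ≈⟨ R.-‿cong (at f≈g i) ⟩
            R.- coef g i    ≈⟨ coef-neg g i ⟨
            coef (-ₚ g) i   ∎ }
      ; comm = +ₚ-comm } }
    where open IsEquivalence ≈ₚ-isEquivalence using (trans)

  private
    module A = AbelianGroup +ₚ-abelianGroup
  open import Algebra.Properties.CommutativeSemigroup A.commutativeSemigroup
    using (interchange; x∙yz≈y∙xz)

  ∷-cong : ∀ {a b f g} → a ≈ b → f ≈ₚ g → a ∷ f ≈ₚ b ∷ g
  ∷-cong a≈b f≈g = mk≈ λ { zero → a≈b ; (suc i) → at f≈g i }

  0∷0 : ∀ {f} → f ≈ₚ [] → 0# ∷ f ≈ₚ []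
  0∷0 f≈0 = mk≈ λ { zero → R.refl ; (suc i) → at f≈0 i }

  0∷-+ : ∀ f g → 0# ∷ f +ₚ g ≈ₚ (0# ∷ f) +ₚ (0# ∷ g)
  0∷-+ f g = ∷-cong (R.sym (R.+-identityˡ 0#)) A.refl

  ·-cong : ∀ {a b f g} → a ≈ b → f ≈ₚ g → a · f ≈ₚ b · g
  ·-cong {a} {b} {f} {g} a≈b f≈g = mk≈ λ i → begin
    coef (a · f) i   ≈⟨ coef-· a f i ⟩
    a R.* coef f i   ≈⟨ R.*-cong a≈b (at f≈g i) ⟩
    b R.* coef g i   ≈⟨ coef-· b g i ⟨
    coef (b · g) i   ∎

  ·-distribˡ : ∀ a f g → a · (f +ₚ g) ≈ₚ a · f +ₚ a · g
  ·-distribˡ a f g = mk≈ λ i → begin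
    coef (a · (f +ₚ g)) i                     ≈⟨ coef-· a (f +ₚ g) i ⟩
    a R.* coef (f +ₚ g) i                     ≈⟨ R.*-congˡ (coef-+ f g i) ⟩
    a R.* (coef f i R.+ coef g i)             ≈⟨ R.distribˡ _ _ _ ⟩
    a R.* coef f i R.+ a R.* coef g i         ≈⟨ R.+-cong (coef-· a f i) (coef-· a g i) ⟨
    coef (a · f) i R.+ coef (a · g) i         ≈⟨ coef-+ (a · f) (a · g) i ⟨
    coef (a · f +ₚ a · g) i                   ∎

  ·-distribʳ : ∀ a b f → (a R.+ b) · f ≈ₚ a · f +ₚ b · f
  ·-distribʳ a b f = mk≈ λ i → begin
    coef ((a R.+ b) · f) i                    ≈⟨ coef-· (a R.+ b) f i ⟩
    (a R.+ b) R.* coef f i                    ≈⟨ R.distribʳ _ _ _ ⟩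
    a R.* coef f i R.+ b R.* coef f i         ≈⟨ R.+-cong (coef-· a f i) (coef-· b f i) ⟨
    coef (a · f) i R.+ coef (b · f) i         ≈⟨ coef-+ (a · f) (b · f) i ⟨
    coef (a · f +ₚ b · f) i                   ∎

  ·-assoc : ∀ a b f → (a R.* b) · f ≈ₚ a · b · f
  ·-assoc a b f = mk≈ λ i → begin
    coef ((a R.* b) · f) i        ≈⟨ coef-· (a R.* b) f i ⟩
    (a R.* b) R.* coef f i        ≈⟨ R.*-assoc _ _ _ ⟩
    a R.* (b R.* coef f i)        ≈⟨ R.*-congˡ (coef-· b f i) ⟨
    a R.* coef (b · f) i          ≈⟨ coef-· a (b · f) i ⟨
    coef (a · b · f) i            ∎

  ·-identity : ∀ f → 1# · f ≈ₚ f
  ·-identity f = mk≈ λ i → R.trans (coef-· 1# f i) (R.*-identityˡ _)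

  ·-zero : ∀ f → 0# · f ≈ₚ []
  ·-zero f = mk≈ λ i → R.trans (coef-· 0# f i) (R.zeroˡ _)

  *ₚ-distribʳ : ∀ h f g → (f +ₚ g) *ₚ h ≈ₚ f *ₚ h +ₚ g *ₚ h
  *ₚ-distribʳ h []      g       = A.refl
  *ₚ-distribʳ h (a ∷ f) []      = A.sym (+ₚ-identityʳ _)
  *ₚ-distribʳ h (a ∷ f) (b ∷ g) = A.trans
    (A.∙-cong (·-distribʳ a b h)
      (A.trans (∷-cong R.refl (*ₚ-distribʳ h f g)) (0∷-+ (f *ₚ h) (g *ₚ h))))
    (interchange (a · h) (b · h) (0# ∷ f *ₚ h) (0# ∷ g *ₚ h))

  *ₚ-distribˡ : ∀ f g h → f *ₚ (g +ₚ h) ≈ₚ f *ₚ g +ₚ f *ₚ h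
  *ₚ-distribˡ []      g h = A.refl
  *ₚ-distribˡ (a ∷ f) g h = A.trans
    (A.∙-cong (·-distribˡ a g h)
      (A.trans (∷-cong R.refl (*ₚ-distribˡ f g h)) (0∷-+ (f *ₚ g) (f *ₚ h))))
    (interchange (a · g) (a · h) (0# ∷ f *ₚ g) (0# ∷ f *ₚ h))

  ·-*ₚ-assoc : ∀ a f g → (a · f) *ₚ g ≈ₚ a · (f *ₚ g)
  ·-*ₚ-assoc a []      g = A.refl
  ·-*ₚ-assoc a (b ∷ f) g = A.trans
    (A.∙-cong (·-assoc a b g) (∷-cong (R.sym (R.zeroʳ a)) (·-*ₚ-assoc a f g)))
    (A.sym (·-distribˡ a (b · g) (0# ∷ f *ₚ g)))

  0∷-*ₚ : ∀ f g → (0# ∷ f) *ₚ g ≈ₚ 0# ∷ f *ₚ g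
  0∷-*ₚ f g = A.∙-congʳ (·-zero g)

  *ₚ-assoc : ∀ f g h → (f *ₚ g) *ₚ h ≈ₚ f *ₚ (g *ₚ h)
  *ₚ-assoc []      g h = A.refl
  *ₚ-assoc (a ∷ f) g h = A.trans
    (*ₚ-distribʳ h (a · g) (0# ∷ f *ₚ g))
    (A.∙-cong (·-*ₚ-assoc a g h)
      (A.trans (0∷-*ₚ (f *ₚ g) h) (∷-cong R.refl (*ₚ-assoc f g h))))

  *ₚ-zeroʳ : ∀ f → f *ₚ [] ≈ₚ []
  *ₚ-zeroʳ []      = A.refl
  *ₚ-zeroʳ (a ∷ f) = 0∷0 (*ₚ-zeroʳ f)

  -- Mirror image of the defining clause of `*ₚ`, which recurses on the first factor. With both
  -- expansions available, commutativity is an induction on the first factor.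
  *ₚ-∷ : ∀ f b g → f *ₚ (b ∷ g) ≈ₚ b · f +ₚ (0# ∷ f *ₚ g)
  *ₚ-∷ []      b g = A.sym (0∷0 A.refl)
  *ₚ-∷ (a ∷ f) b g = ∷-cong (R.+-congʳ (R.*-comm a b)) (A.trans
    (A.∙-congˡ (*ₚ-∷ f b g))
    (x∙yz≈y∙xz (a · g) (b · f) (0# ∷ f *ₚ g)))

  *ₚ-comm : ∀ f g → f *ₚ g ≈ₚ g *ₚ f
  *ₚ-comm []      g = A.sym (*ₚ-zeroʳ g)
  *ₚ-comm (a ∷ f) g = A.trans
    (A.∙-congˡ (∷-cong R.refl (*ₚ-comm f g))) (A.sym (*ₚ-∷ g a f))

  *ₚ-congˡ : ∀ f {g h} → g ≈ₚ h → f *ₚ g ≈ₚ f *ₚ h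
  *ₚ-congˡ []      g≈h = A.refl
  *ₚ-congˡ (a ∷ f) g≈h = A.∙-cong (·-cong R.refl g≈h) (∷-cong R.refl (*ₚ-congˡ f g≈h))

  *ₚ-cong : ∀ {f f′ g g′} → f ≈ₚ f′ → g ≈ₚ g′ → f *ₚ g ≈ₚ f′ *ₚ g′
  *ₚ-cong {f} {f′} {g} {g′} f≈ g≈ = A.trans (*ₚ-congˡ f g≈)
    (A.trans (*ₚ-comm f g′) (A.trans (*ₚ-congˡ g′ f≈) (*ₚ-comm g′ f′)))

  *ₚ-identityˡ : ∀ f → (1# ∷ []) *ₚ f ≈ₚ f
  *ₚ-identityˡ f = A.trans (A.∙-cong (·-identity f) (0∷0 A.refl)) (+ₚ-identityʳ f)

  polynomialRing : CommutativeRing c ℓ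
  polynomialRing = record
    { Carrier = Poly
    ; _≈_ = _≈ₚ_
    ; _+_ = _+ₚ_
    ; _*_ = _*ₚ_
    ; -_ = -ₚ_
    ; 0# = []
    ; 1# = 1# ∷ []
    ; isCommutativeRing = record
      { isRing = record
        { +-isAbelianGroup = A.isAbelianGroup
        ; *-cong = *ₚ-cong
        ; *-assoc = *ₚ-assoc
        ; *-identity = *ₚ-identityˡ , λ f → A.trans (*ₚ-comm f _) (*ₚ-identityˡ f)
        ; distrib = *ₚ-distribˡ , *ₚ-distribʳ
        }
      ; *-comm = *ₚ-comm
      }
    }

  private module P = CommutativeRing polynomialRing

  -- An upper bound replaces the degree: the zero polynomial fits in, and no coefficient has to be
  -- tested for being zero, which cannot be decided over a general ring.
  record Deg< (d : ℕ) (f : Poly) : Set ℓ where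
    constructor mk<
    field vanish : ∀ i → d ℕ.≤ i → coef f i ≈ 0#
  open Deg< public

  record Monic (d : ℕ) (f : Poly) : Set ℓ where
    field
      leading : coef f d ≈ 1#
      above   : Deg< (suc d) f
  open Monic public

  Deg<-resp : ∀ {d f g} → f ≈ₚ g → Deg< d f → Deg< d g
  Deg<-resp f≈g f< = mk< λ i d≤i → R.trans (R.sym (at f≈g i)) (vanish f< i d≤i)

  Deg<-weaken : ∀ {d e f} → d ℕ.≤ e → Deg< d f → Deg< e f
  Deg<-weaken d≤e f< = mk< λ i e≤i → vanish f< i (ℕ.≤-trans d≤e e≤i)

  Deg<-0 : ∀ {f} → Deg< 0 f → f ≈ₚ []
  Deg<-0 f< = mk≈ λ i → vanish f< i z≤n

  Deg<-+ : ∀ {d f g} → Deg< d f → Deg< d g → Deg< d (f +ₚ g)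
  Deg<-+ {f = f} {g} f< g< = mk< λ i d≤i → begin
    coef (f +ₚ g) i        ≈⟨ coef-+ f g i ⟩
    coef f i R.+ coef g i  ≈⟨ R.+-cong (vanish f< i d≤i) (vanish g< i d≤i) ⟩
    0# R.+ 0#              ≈⟨ R.+-identityˡ 0# ⟩
    0#                     ∎

  Deg<-· : ∀ {d} a {f} → Deg< d f → Deg< d (a · f)
  Deg<-· a {f} f< = mk< λ i d≤i → begin
    coef (a · f) i   ≈⟨ coef-· a f i ⟩
    a R.* coef f i   ≈⟨ R.*-congˡ (vanish f< i d≤i) ⟩
    a R.* 0#         ≈⟨ R.zeroʳ a ⟩
    0#               ∎

  Deg<-∷ : ∀ {d} a {f} → Deg< d f → Deg< (suc d) (a ∷ f)
  Deg<-∷ a f< = mk< λ { (suc i) (s≤s d≤i) → vanish f< i d≤i }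

  Deg<-tail : ∀ {d a f} → Deg< (suc d) (a ∷ f) → Deg< d f
  Deg<-tail f< = mk< λ i d≤i → vanish f< (suc i) (s≤s d≤i)

  -- Of the products contributing to index `d + e`, all but one involve a coefficient beyond one of
  -- the two bounds.
  coef-*-leading : ∀ {d e} f g → Deg< (suc d) f → Deg< (suc e) g →
                   coef (f *ₚ g) (d ℕ.+ e) ≈ coef f d R.* coef g e
  coef-*-leading []  g f< g< = R.sym (R.zeroˡ _)
  coef-*-leading {zero} {e} (a ∷ f) g f< g< = begin
    coef (a · g +ₚ (0# ∷ f *ₚ g)) e                ≈⟨ coef-+ (a · g) _ e ⟩
    coef (a · g) e R.+ coef (0# ∷ f *ₚ g) e        ≈⟨ R.+-cong (coef-· a g e) (at (0∷0 f*g≈0) e) ⟩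
    a R.* coef g e R.+ 0#                          ≈⟨ R.+-identityʳ _ ⟩
    a R.* coef g e                                 ∎
    where
    f*g≈0 : f *ₚ g ≈ₚ []
    f*g≈0 = *ₚ-cong (Deg<-0 (Deg<-tail f<)) (A.refl {g})
  coef-*-leading {suc d} {e} (a ∷ f) g f< g< = begin
    coef (a · g +ₚ (0# ∷ f *ₚ g)) (suc d ℕ.+ e)    ≈⟨ coef-+ (a · g) _ (suc d ℕ.+ e) ⟩
    coef (a · g) (suc d ℕ.+ e) R.+ coef (f *ₚ g) (d ℕ.+ e)
      ≈⟨ R.+-cong (vanish (Deg<-· a g<) _ (s≤s (ℕ.m≤n+m e d)))
                  (coef-*-leading f g (Deg<-tail f<) g<) ⟩
    0# R.+ coef f d R.* coef g e                   ≈⟨ R.+-identityˡ _ ⟩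
    coef f d R.* coef g e                          ∎

  Deg<-* : ∀ {d e f g} → Deg< d f → Deg< (suc e) g → Deg< (d ℕ.+ e) (f *ₚ g)
  Deg<-* {zero} {f = f} {g} f< g< = mk< λ i _ → at (*ₚ-cong (Deg<-0 f<) (A.refl {g})) i
  Deg<-* {suc d} {e} {[]}    {g} f< g< = mk< λ _ _ → R.refl
  Deg<-* {suc d} {e} {a ∷ f} {g} f< g< =
    Deg<-+ {f = a · g} (Deg<-weaken (s≤s (ℕ.m≤n+m e d)) (Deg<-· a g<))
           (Deg<-∷ 0# (Deg<-* {d} {f = f} {g} (Deg<-tail f<) g<))

  Monic-* : ∀ {d e f g} → Monic d f → Monic e g → Monic (d ℕ.+ e) (f *ₚ g)
  Monic-* {f = f} {g} mf mg = record
    { leading = begin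
        _             ≈⟨ coef-*-leading f g (above mf) (above mg) ⟩
        _             ≈⟨ R.*-cong (leading mf) (leading mg) ⟩
        1# R.* 1#     ≈⟨ R.*-identityˡ 1# ⟩
        1#            ∎
    ; above = Deg<-* {f = f} {g} (above mf) (above mg)
    }

  Monic-resp : ∀ {d f g} → f ≈ₚ g → Monic d f → Monic d g
  Monic-resp f≈g mf = record
    { leading = R.trans (R.sym (at f≈g _)) (leading mf)
    ; above   = Deg<-resp f≈g (above mf)
    }

  -- If `f ≈ₚ u *ₚ p +ₚ r`, then `a ∷ f` is X u p plus `a ∷ r`, whose degree is at most `d`.
  -- Subtracting `b · p`, with `b` the coefficient of `a ∷ r` at `d`, cancels the top because `p` is
  -- monic, and the quotient becomes `b ∷ u`.
  division : ∀ {d p} → Monic d p → ∀ f → ∃₂ λ u r → f ≈ₚ u *ₚ p +ₚ r × Deg< d r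
  division mp [] = [] , [] , A.refl , mk< λ _ _ → R.refl
  division {d} {p} mp (a ∷ f) with division mp f
  ... | u , r , f≈up+r , r< = b ∷ u , (a ∷ r) +ₚ -ₚ (b · p) , eq , deg
    where
    b = coef (a ∷ r) d
    eq : a ∷ f ≈ₚ (b · p +ₚ (0# ∷ u *ₚ p)) +ₚ ((a ∷ r) +ₚ -ₚ (b · p))
    eq = A.trans (∷-cong (R.sym (R.+-identityˡ a)) f≈up+r)
      (A.trans (A.sym (A.identityʳ _))
      (A.trans (A.∙-congˡ {0# R.+ a ∷ u *ₚ p +ₚ r} (A.sym (+ₚ-inverseʳ (b · p))))
      (A.trans (interchange (0# ∷ u *ₚ p) (a ∷ r) (b · p) (-ₚ (b · p)))
      (A.∙-congʳ (+ₚ-comm (0# ∷ u *ₚ p) (b · p))))))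
    deg : Deg< d ((a ∷ r) +ₚ -ₚ (b · p))
    deg = mk< λ i d≤i → R.trans (coef-+ (a ∷ r) (-ₚ (b · p)) i) (R.trans (R.+-congˡ
      (R.trans (coef-neg (b · p) i) (R.-‿cong (coef-· b p i)))) (cancel i (ℕ.m≤n⇒m<n∨m≡n d≤i)))
      where
      cancel : ∀ i → d ℕ.< i ⊎ d ≡ i → coef (a ∷ r) i R.+ R.- (b R.* coef p i) ≈ 0#
      cancel i (inj₁ d<i)  = begin
        coef (a ∷ r) i R.+ R.- (b R.* coef p i)
          ≈⟨ R.+-cong (vanish (Deg<-∷ a r<) i d<i) (R.-‿cong (R.*-congˡ (vanish (above mp) i d<i))) ⟩
        0# R.+ R.- (b R.* 0#)   ≈⟨ R.+-identityˡ _ ⟩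
        R.- (b R.* 0#)          ≈⟨ R.-‿cong (R.zeroʳ b) ⟩
        R.- 0#                  ≈⟨ -0#≈0# ⟩
        0#                      ∎
      cancel i (inj₂ ≡.refl) = begin
        b R.+ R.- (b R.* coef p d)  ≈⟨ R.+-congˡ (R.-‿cong (R.*-congˡ (leading mp))) ⟩
        b R.+ R.- (b R.* 1#)        ≈⟨ R.+-congˡ (R.-‿cong (R.*-identityʳ b)) ⟩
        b R.+ R.- b                 ≈⟨ R.-‿inverseʳ b ⟩
        0#                          ∎

  -- For `i ≥ d`, coefficient `suc i` of `(b ∷ u) *ₚ p` is that of `u *ₚ p` at `i`, as `p` has no
  -- coefficient above `d`. So `u` vanishes by induction, and coefficient `d` of the product is then
  -- `b` itself.
  multiple-small⇒0 : ∀ {d p} → Monic d p → ∀ u → Deg< d (u *ₚ p) → u ≈ₚ []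
  multiple-small⇒0 mp [] up< = A.refl
  multiple-small⇒0 {d} {p} mp (b ∷ u) up< = A.trans (∷-cong b≈0 u≈0) (0∷0 A.refl)
    where
    expand : ∀ i → coef ((b ∷ u) *ₚ p) i ≈ b R.* coef p i R.+ coef (0# ∷ u *ₚ p) i
    expand i = R.trans (coef-+ (b · p) _ i) (R.+-congʳ (coef-· b p i))
    u≈0 : u ≈ₚ []
    u≈0 = multiple-small⇒0 mp u (mk< λ i d≤i → begin
      coef (u *ₚ p) i                                       ≈⟨ R.+-identityˡ _ ⟨
      0# R.+ coef (u *ₚ p) i                                ≈⟨ R.+-congʳ (R.trans (R.*-congˡ (vanish (above mp) (suc i) (s≤s d≤i))) (R.zeroʳ b)) ⟨
      b R.* coef p (suc i) R.+ coef (u *ₚ p) i              ≈⟨ expand (suc i) ⟨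
      coef ((b ∷ u) *ₚ p) (suc i)                           ≈⟨ vanish up< (suc i) (ℕ.m≤n⇒m≤1+n d≤i) ⟩
      0#                                                    ∎)
    b≈0 : b ≈ 0#
    b≈0 = begin
      b                                            ≈⟨ R.*-identityʳ b ⟨
      b R.* 1#                                     ≈⟨ R.*-congˡ (leading mp) ⟨
      b R.* coef p d                               ≈⟨ R.+-identityʳ _ ⟨
      b R.* coef p d R.+ 0#                        ≈⟨ R.+-congˡ (at (0∷0 (*ₚ-cong u≈0 (A.refl {p}))) d) ⟨
      b R.* coef p d R.+ coef (0# ∷ u *ₚ p) d      ≈⟨ expand d ⟨
      coef ((b ∷ u) *ₚ p) d                        ≈⟨ vanish up< d ℕ.≤-refl ⟩
      0#                                           ∎

-- The quotient of a commutative ring by a principal ideal.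

module Congruences {c ℓ} (R : CommutativeRing c ℓ) (p : CommutativeRing.Carrier R) where
  open CommutativeRing R
  open import Algebra.Properties.Ring ring using (-‿distribˡ-*)
  open import Algebra.Properties.AbelianGroup +-abelianGroup using (⁻¹-∙-comm)
  open import Algebra.Solver.Ring.NaturalCoefficients.Default commutativeSemiring

  infix 4 _≡ₘ_
  record _≡ₘ_ (x y : Carrier) : Set (c ⊔ ℓ) where
    constructor mod
    field
      factor   : Carrier
      equation : x ≈ y + factor * p
  open _≡ₘ_ public

  ≈⇒≡ₘ : ∀ {x y} → x ≈ y → x ≡ₘ y
  ≈⇒≡ₘ x≈y = mod 0# (trans x≈y (sym (trans (+-congˡ (zeroˡ p)) (+-identityʳ _))))

  ≡ₘ-sym : ∀ {x y} → x ≡ₘ y → y ≡ₘ x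
  ≡ₘ-sym {x} {y} (mod u eq) = mod (- u) (begin
    y                             ≈⟨ +-identityʳ y ⟨
    y + 0#                        ≈⟨ +-congˡ (-‿inverseʳ (u * p)) ⟨
    y + (u * p + - (u * p))       ≈⟨ +-assoc _ _ _ ⟨
    (y + u * p) + - (u * p)       ≈⟨ +-cong (sym eq) (-‿distribˡ-* u p) ⟩
    x + (- u) * p                 ∎)
    where open import Relation.Binary.Reasoning.Setoid setoid

  ≡ₘ-trans : ∀ {x y z} → x ≡ₘ y → y ≡ₘ z → x ≡ₘ z
  ≡ₘ-trans {z = z} (mod u eq) (mod v eq′) = mod (v + u)
    (trans eq (trans (+-congʳ eq′)
      (solve 4 (λ z u v p → (z :+ v :* p) :+ u :* p := z :+ (v :+ u) :* p) refl z u v p)))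

  ≡ₘ-+-cong : ∀ {x x′ y y′} → x ≡ₘ x′ → y ≡ₘ y′ → x + y ≡ₘ x′ + y′
  ≡ₘ-+-cong {x′ = x} {y′ = y} (mod u eq) (mod v eq′) = mod (u + v) (trans (+-cong eq eq′)
    (solve 5 (λ x y u v p → (x :+ u :* p) :+ (y :+ v :* p) := (x :+ y) :+ (u :+ v) :* p)
      refl x y u v p))

  ≡ₘ-*-cong : ∀ {x x′ y y′} → x ≡ₘ x′ → y ≡ₘ y′ → x * y ≡ₘ x′ * y′
  ≡ₘ-*-cong {x′ = x} {y′ = y} (mod u eq) (mod v eq′) = mod (u * y + x * v + u * v * p)
    (trans (*-cong eq eq′)
    (solve 5 (λ x y u v p → (x :+ u :* p) :* (y :+ v :* p)
        := x :* y :+ (u :* y :+ x :* v :+ u :* v :* p) :* p)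
      refl x y u v p))

  ≡ₘ-neg-cong : ∀ {x y} → x ≡ₘ y → - x ≡ₘ - y
  ≡ₘ-neg-cong {x} {y} (mod u eq) = mod (- u)
    (trans (-‿cong eq) (trans (sym (⁻¹-∙-comm y (u * p))) (+-congˡ (-‿distribˡ-* u p))))

  -- Carrier and operations are kept and only equality is coarsened, so the ring laws are inherited
  -- through `≈⇒≡ₘ`.
  quotientRing : CommutativeRing c (c ⊔ ℓ)
  quotientRing = record
    { Carrier = Carrier
    ; _≈_ = _≡ₘ_
    ; _+_ = _+_
    ; _*_ = _*_
    ; -_ = -_
    ; 0# = 0#
    ; 1# = 1#
    ; isCommutativeRing = record
      { isRing = record
        { +-isAbelianGroup = record
          { isGroup = record
            { isMonoid = record
              { isSemigroup = record
                { isMagma = record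
                  { isEquivalence = record
                    { refl = ≈⇒≡ₘ refl ; sym = ≡ₘ-sym ; trans = ≡ₘ-trans }
                  ; ∙-cong = ≡ₘ-+-cong }
                ; assoc = λ x y z → ≈⇒≡ₘ (+-assoc x y z) }
              ; identity = (λ x → ≈⇒≡ₘ (+-identityˡ x)) , λ x → ≈⇒≡ₘ (+-identityʳ x) }
            ; inverse = (λ x → ≈⇒≡ₘ (-‿inverseˡ x)) , λ x → ≈⇒≡ₘ (-‿inverseʳ x)
            ; ⁻¹-cong = ≡ₘ-neg-cong }
          ; comm = λ x y → ≈⇒≡ₘ (+-comm x y) }
        ; *-cong = ≡ₘ-*-cong
        ; *-assoc = λ x y z → ≈⇒≡ₘ (*-assoc x y z)
        ; *-identity = (λ x → ≈⇒≡ₘ (*-identityˡ x)) , λ x → ≈⇒≡ₘ (*-identityʳ x)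
        ; distrib = (λ x y z → ≈⇒≡ₘ (distribˡ x y z)) , λ x y z → ≈⇒≡ₘ (distribʳ x y z)
        }
      ; *-comm = λ x y → ≈⇒≡ₘ (*-comm x y)
      }
    }

-- Counting roots over a field.

module Fields {c ℓ} (K : CommutativeRing c ℓ) (isField : IsField K) where
  open CommutativeRing K hiding (zero)
  open IsField isField public
  open import Algebra.Properties.Ring ring using (-1*x≈-x; [y-z]x≈yx-zx)
  open import Algebra.Properties.Group +-group using (x∙y⁻¹≈ε⇒x≈y; x≈y⇒x∙y⁻¹≈ε)
  open import Algebra.Properties.Semiring.Exp semiring
  open import Algebra.Solver.Ring.NaturalCoefficients.Default commutativeSemiring
  open import Relation.Binary.Reasoning.Setoid setoid

  *-cancelˡ-≉0 : ∀ {x y} → ¬ x ≈ 0# → x * y ≈ 0# → y ≈ 0#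
  *-cancelˡ-≉0 {x} {y} x≉0 xy≈0 with ≉0⇒invertible x x≉0
  ... | x⁻¹ , x⁻¹x≈1 , _ = begin
    y                ≈⟨ *-identityˡ y ⟨
    1# * y           ≈⟨ *-congʳ x⁻¹x≈1 ⟨
    x⁻¹ * x * y      ≈⟨ *-assoc _ _ _ ⟩
    x⁻¹ * (x * y)    ≈⟨ *-congˡ xy≈0 ⟩
    x⁻¹ * 0#         ≈⟨ zeroʳ _ ⟩
    0#               ∎

  *-injectiveˡ-≉0 : ∀ {x y z} → ¬ x ≈ 0# → x * y ≈ x * z → y ≈ z
  *-injectiveˡ-≉0 {x} {y} {z} x≉0 xy≈xz = x∙y⁻¹≈ε⇒x≈y y z (*-cancelˡ-≉0 x≉0
    (trans (x[y-z]≈xy-xz x y z) (x≈y⇒x∙y⁻¹≈ε xy≈xz)))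
    where open import Algebra.Properties.Ring ring using (x[y-z]≈xy-xz)

  *-equalʳ⇒≈0 : ∀ {x y z} → ¬ x ≈ y → x * z ≈ y * z → z ≈ 0#
  *-equalʳ⇒≈0 {x} {y} {z} x≉y xz≈yz = *-cancelˡ-≉0 (λ x-y≈0 → x≉y (x∙y⁻¹≈ε⇒x≈y x y x-y≈0))
    (trans ([y-z]x≈yx-zx z x y) (x≈y⇒x∙y⁻¹≈ε xz≈yz))

  eval : List Carrier → Carrier → Carrier
  eval []       x = 0#
  eval (a ∷ as) x = a + x * eval as x

  -- Synthetic division: each entry is the value at `x` of the list from that position on. Applied
  -- to `as`, it gives the quotient of f(X) - f(x) by X - x for `f = a ∷ as`.
  deflate : List Carrier → Carrier → List Carrier
  deflate []       x = []
  deflate (a ∷ as) x = eval (a ∷ as) x ∷ deflate as x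

  length-deflate : ∀ as x → length (deflate as x) ≡ length as
  length-deflate []       x = ≡.refl
  length-deflate (a ∷ as) x = ≡.cong suc (length-deflate as x)

  -- f(x) − f(y) = (x − y) g(x) for f = a + X·as and g the deflation at y, with
  -- both sides moved so that no subtraction occurs.
  eval-deflate : ∀ a as x y →
    eval (a ∷ as) x + y * eval (deflate as y) x ≈ eval (a ∷ as) y + x * eval (deflate as y) x
  eval-deflate a []       x y =
    solve 3 (λ a x y → (a :+ x :* con 0) :+ y :* con 0 := (a :+ y :* con 0) :+ x :* con 0)
      refl a x y
  eval-deflate a (b ∷ bs) x y = begin
    (a + x * E x) + y * (E y + x * S)
      ≈⟨ solve 6 (λ a x y e e′ s → (a :+ x :* e) :+ y :* (e′ :+ x :* s)
            := a :+ y :* e′ :+ x :* (e :+ y :* s)) refl a x y (E x) (E y) S ⟩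
    a + y * E y + x * (E x + y * S)
      ≈⟨ +-congˡ (*-congˡ (eval-deflate b bs x y)) ⟩
    a + y * E y + x * (E y + x * S) ∎
    where
    E = eval (b ∷ bs)
    S = eval (deflate bs y) x

  -- The passage from coefficients to Horner values is triangular: `a` is recovered from the values
  -- of `a ∷ as` and of `as`. The value of `as` is carried along for this purpose.
  deflate-zeros : ∀ as x → All (_≈ 0#) (deflate as x) → All (_≈ 0#) as × eval as x ≈ 0#
  deflate-zeros []       x []           = [] , refl
  deflate-zeros (a ∷ as) x (fx≈0 ∷ zs) with deflate-zeros as x zs
  ... | as≈0 , gx≈0 = a≈0 ∷ as≈0 , fx≈0
    where
    a≈0 : a ≈ 0#
    a≈0 = trans (sym (trans (+-congˡ (trans (*-congˡ gx≈0) (zeroʳ x))) (+-identityʳ a))) fx≈0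

  -- The length of the list serves as degree plus one, so zero top coefficients are harmless.
  -- Dividing out the first root leaves a list shorter by one that vanishes at the remaining roots.
  too-many-roots : ∀ as {k} (r : Fin k → Carrier) → (∀ {i j} → r i ≈ r j → i ≡ j) →
                   length as ℕ.≤ k → (∀ i → eval as (r i) ≈ 0#) → All (_≈ 0#) as
  too-many-roots []       r r-inj _         roots = []
  too-many-roots (a ∷ as) {suc k} r r-inj (s≤s l≤k) roots = a≈0 ∷ as≈0
    where
    y = r zero
    -- Both values of `a ∷ as` are zero, so `eval-deflate` reads y g(x) = x g(x) with x ≠ y, where g
    -- is the deflation at y.
    roots′ : ∀ i → eval (deflate as y) (r (suc i)) ≈ 0#
    roots′ i = *-equalʳ⇒≈0 (λ x≈y → Fin.0≢1+n (≡.sym (r-inj x≈y))) (sym (begin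
      y * S                          ≈⟨ +-identityˡ _ ⟨
      0# + y * S                     ≈⟨ +-congʳ (roots (suc i)) ⟨
      eval (a ∷ as) x + y * S        ≈⟨ eval-deflate a as x y ⟩
      eval (a ∷ as) y + x * S        ≈⟨ +-congʳ (roots zero) ⟩
      0# + x * S                     ≈⟨ +-identityˡ _ ⟩
      x * S                          ∎))
      where
      x = r (suc i)
      S = eval (deflate as y) x
    as≈0×root : All (_≈ 0#) as × eval as y ≈ 0#
    as≈0×root = deflate-zeros as y (too-many-roots (deflate as y) (r ∘ suc)
      (λ eq → Fin.suc-injective (r-inj eq))
      (≡.subst (ℕ._≤ k) (≡.sym (length-deflate as y)) l≤k) roots′)
    as≈0 = proj₁ as≈0×root
    a≈0 : a ≈ 0#
    a≈0 = trans (sym (trans (+-congˡ (trans (*-congˡ (proj₂ as≈0×root)) (zeroʳ y)))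
      (+-identityʳ a))) (roots zero)

  private
    power : ℕ → List Carrier
    power t = replicate t 0# ++ 1# ∷ []

    eval-power : ∀ t x → eval (power t) x ≈ x ^ t
    eval-power zero    x = trans (+-congˡ (zeroʳ x)) (+-identityʳ 1#)
    eval-power (suc t) x = trans (+-identityˡ _) (*-congˡ (eval-power t x))

    length-power : ∀ t → length (power t) ≡ suc t
    length-power zero    = ≡.refl
    length-power (suc t) = ≡.cong suc (length-power t)

    power≉0 : ∀ t → ¬ All (_≈ 0#) (power t)
    power≉0 zero    (1≈0 ∷ _) = 0≉1 (sym 1≈0)
    power≉0 (suc t) (_ ∷ zs)  = power≉0 t zs

  -- More than `M` fixed points would be too many roots for X^M - X, whose top coefficient is 1. The
  -- bound `2 ≤ M` keeps the terms X^M and -X apart.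
  fixed-by-power⇒≤ : ∀ {M k} → 2 ℕ.≤ M → (r : Fin k → Carrier) →
    (∀ {i j} → r i ≈ r j → i ≡ j) → (∀ i → r i ^ M ≈ r i) → k ℕ.≤ M
  fixed-by-power⇒≤ {suc (suc t)} {k} (s≤s (s≤s z≤n)) r r-inj fixed =
    ℕ.≮⇒≥ λ M<k → power≉0 t (tail (tail (too-many-roots X^M-X r r-inj
      (≡.subst (λ l → suc (suc l) ℕ.≤ k) (≡.sym (length-power t)) M<k) roots)))
    where
    X^M-X = 0# ∷ - 1# ∷ power t
    roots : ∀ i → eval X^M-X (r i) ≈ 0#
    roots i = begin
      0# + x * (- 1# + x * eval (power t) x)  ≈⟨ +-identityˡ _ ⟩
      x * (- 1# + x * eval (power t) x)       ≈⟨ *-congˡ (+-congˡ (*-congˡ (eval-power t x))) ⟩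
      x * (- 1# + x * x ^ t)                  ≈⟨ distribˡ _ _ _ ⟩
      x * - 1# + x * (x * x ^ t)              ≈⟨ +-cong (*-comm _ _) (fixed i) ⟩
      - 1# * x + x                            ≈⟨ +-congʳ (-1*x≈-x x) ⟩
      - x + x                                 ≈⟨ -‿inverseˡ x ⟩
      0#                                      ∎
      where x = r i

-- Finite fields and Fermat's little theorem.

module FiniteFields {c ℓ} (K : CommutativeRing c ℓ) (isField : IsField K)
                    {N : ℕ} (finite : CommutativeRing.setoid K HasCardinality N) where
  open CommutativeRing K hiding (zero)
  open Fields K isField
  open import Algebra.Properties.Semiring.Exp semiring
  open import Relation.Binary.Reasoning.Setoid setoid
  private module B = Bijection finite

  element : Fin N → Carrier
  element = B.to

  index : Carrier → Fin N
  index = B.to⁻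

  element-index : ∀ x → element (index x) ≈ x
  element-index x = proj₂ (B.surjective x) ≡.refl

  element-injective : ∀ {i j} → element i ≈ element j → i ≡ j
  element-injective = B.injective

  index-cong : ∀ {x y} → x ≈ y → index x ≡ index y
  index-cong x≈y = B.injective (trans (element-index _) (trans x≈y (sym (element-index _))))

  index-injective : ∀ {x y} → index x ≡ index y → x ≈ y
  index-injective eq = trans (sym (element-index _)) (trans (B.cong eq) (element-index _))

  infix 4 _≟_
  _≟_ : Decidable _≈_
  x ≟ y = map′ index-injective index-cong (index x Fin.≟ index y)

  2≤N : 2 ℕ.≤ N
  2≤N = go 0≉1′
    where
    0≉1′ : index 0# ≢ index 1#
    0≉1′ eq = 0≉1 (index-injective eq)
    go : ∀ {n} {i j : Fin n} → i ≢ j → 2 ℕ.≤ n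
    go {suc zero} {zero} {zero} i≢j = contradiction ≡.refl i≢j
    go {suc (suc n)}            i≢j = s≤s (s≤s z≤n)

  private module ∏ where
    open import Algebra.Properties.CommutativeMonoid.Sum *-commutativeMonoid public

  module _ {y : Carrier} (y≉0 : ¬ y ≈ 0#) where
    private
      y⁻¹ = proj₁ (≉0⇒invertible y y≉0)

      cancel : ∀ {a b} → a * b ≈ 1# → ∀ x → a * (b * x) ≈ x
      cancel ab≈1 x = trans (sym (*-assoc _ _ x)) (trans (*-congʳ ab≈1) (*-identityˡ x))

      shift : Carrier → Fin N → Fin N
      shift a i = index (a * element i)

      shift-inverse : ∀ {a b} → a * b ≈ 1# → ∀ i → shift a (shift b i) ≡ i
      shift-inverse ab≈1 i = element-injective
        (trans (element-index _) (trans (*-congˡ (element-index _)) (cancel ab≈1 (element i))))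

      π = permutation (shift y) (shift y⁻¹)
        (shift-inverse (proj₂ (proj₂ (≉0⇒invertible y y≉0))))
        (shift-inverse (proj₁ (proj₂ (≉0⇒invertible y y≉0))))

      -- Makes the zero element contribute the factor 1, so that products over the nonzero elements
      -- may run over all of `Fin N`.
      onUnit : Carrier → Carrier → Carrier
      onUnit x z with x ≟ 0#
      ... | yes _ = 1#
      ... | no  _ = z

      w u : Fin N → Carrier
      w i = onUnit (element i) (element i)
      u i = onUnit (element i) y

      w-shift : ∀ i → w (shift y i) ≈ w i * u i
      w-shift i with element (shift y i) ≟ 0# | element i ≟ 0#
      ... | yes _   | yes _  = sym (*-identityˡ 1#)
      ... | yes z≈0 | no x≉0 =
        contradiction (*-cancelˡ-≉0 y≉0 (trans (sym (element-index _)) z≈0)) x≉0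
      ... | no z≉0  | yes x≈0 =
        contradiction (trans (element-index _) (trans (*-congˡ x≈0) (zeroʳ y))) z≉0
      ... | no _    | no _    = trans (element-index _) (*-comm _ _)

      onUnit≉0 : ∀ x → ¬ onUnit x x ≈ 0#
      onUnit≉0 x with x ≟ 0#
      ... | yes _  = λ 1≈0 → 0≉1 (sym 1≈0)
      ... | no x≉0 = x≉0

      ∏≉0 : ∀ {n} (t : Fin n → Carrier) → (∀ i → ¬ t i ≈ 0#) → ¬ ∏.sum t ≈ 0#
      ∏≉0 {zero}  t t≉0 1≈0 = 0≉1 (sym 1≈0)
      ∏≉0 {suc n} t t≉0 p≈0 = ∏≉0 (t ∘ suc) (t≉0 ∘ suc) (*-cancelˡ-≉0 (t≉0 zero) p≈0)

      -- Multiplication by `y` permutes the indices, which leaves the product of `w` unchanged, but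
      -- by `w-shift` it also multiplies that product by the product of `u`. The product of `w` is
      -- nonzero and cancels.
      ∏u≈1 : ∏.sum u ≈ 1#
      ∏u≈1 = *-injectiveˡ-≉0 (∏≉0 w (λ i → onUnit≉0 (element i))) (begin
        ∏.sum w * ∏.sum u              ≈⟨ ∏.∑-distrib-+ w u ⟨
        ∏.sum (λ i → w i * u i)        ≈⟨ ∏.sum-cong-≋ w-shift ⟨
        ∏.sum (λ i → w (π ⟨$⟩ʳ i))     ≈⟨ ∏.sum-permute w π ⟨
        ∏.sum w                        ≈⟨ *-identityʳ _ ⟨
        ∏.sum w * 1#                   ∎)

      -- The extra factor `y` stands in for the exceptional entry, so the exponent is `n` rather
      -- than a truncated difference.
      ∏-exceptional : ∀ {n} (i : Fin n) (t : Fin n → Carrier) → t i ≈ 1# →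
                      (∀ j → j ≢ i → t j ≈ y) → y * ∏.sum t ≈ y ^ n
      ∏-exceptional {suc n} i t ti≈1 t≈y = *-congˡ (begin
        ∏.sum t                               ≈⟨ ∏.sum-remove {i = i} t ⟩
        t i * ∏.sum (removeAt t i)            ≈⟨ *-congʳ ti≈1 ⟩
        1# * ∏.sum (removeAt t i)             ≈⟨ *-identityˡ _ ⟩
        ∏.sum (removeAt t i)                  ≈⟨ ∏.sum-cong-≋ (λ j → t≈y (punchIn i j) (Fin.punchInᵢ≢i i j)) ⟩
        ∏.sum {n} (λ _ → y)                   ≈⟨ ∏.sum-replicate n ⟩
        y ^ n                                 ∎)

      u-0 : u (index 0#) ≈ 1#
      u-0 with element (index 0#) ≟ 0#
      ... | yes _   = refl
      ... | no ≉0 = contradiction (element-index 0#) ≉0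

      u-≢0 : ∀ j → j ≢ index 0# → u j ≈ y
      u-≢0 j j≢ with element j ≟ 0#
      ... | yes ≈0 = contradiction (element-injective (trans ≈0 (sym (element-index 0#)))) j≢
      ... | no _   = refl

    fermat-≉0 : y ^ N ≈ y
    fermat-≉0 = begin
      y ^ N         ≈⟨ ∏-exceptional (index 0#) u u-0 u-≢0 ⟨
      y * ∏.sum u   ≈⟨ *-congˡ ∏u≈1 ⟩
      y * 1#        ≈⟨ *-identityʳ y ⟩
      y             ∎

  fermat : ∀ y → y ^ N ≈ y
  fermat y with y ≟ 0#
  ... | no y≉0  = fermat-≉0 y≉0
  ... | yes y≈0 = begin
    y ^ N     ≈⟨ ^-congˡ N y≈0 ⟩
    0# ^ N    ≈⟨ 0^ 2≤N ⟩
    0#        ≈⟨ y≈0 ⟨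
    y         ∎
    where
    0^ : ∀ {n} → 2 ℕ.≤ n → 0# ^ n ≈ 0#
    0^ (s≤s _) = zeroˡ _

-- Additivity of powers whose inner binomial coefficients vanish.

module FreshmansDream {c ℓ} (A : CommutativeRing c ℓ) where
  open CommutativeRing A hiding (zero)
  open import Algebra.Properties.CommutativeSemiring.Binomial commutativeSemiring
    using (binomialTerm; theorem)
  open import Algebra.Properties.Semiring.Exp semiring
  open import Algebra.Properties.Semiring.Mult semiring renaming (_×_ to _·ℕ_)
  open import Algebra.Properties.Semiring.Sum semiring
  open import Relation.Binary.Reasoning.Setoid setoid

  binomial-middle : ∀ m x y → Carrier
  binomial-middle m x y = ∑[ i < m ] binomialTerm x y (suc m) (suc (inject₁ i))

  nC0≡1 : ∀ n → n C 0 ≡ 1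
  nC0≡1 n = ≡.trans (≡.cong (n C_) (≡.sym (ℕ.n∸n≡0 n)))
    (≡.trans (≡.sym (nCk≡nC[n∸k] {n} {n} ℕ.≤-refl)) (nCn≡1 n))

  binomial-split : ∀ m x y →
    (x + y) ^ suc m ≈ y ^ suc m + (binomial-middle m x y + x ^ suc m)
  binomial-split m x y = begin
    (x + y) ^ suc m                     ≈⟨ theorem (suc m) x y ⟩
    t zero + sum (t ∘ suc)              ≈⟨ +-congˡ (sum-init-last (t ∘ suc)) ⟩
    t zero + (binomial-middle m x y + t (suc (fromℕ m)))
      ≈⟨ +-cong first (+-congˡ last) ⟩
    y ^ suc m + (binomial-middle m x y + x ^ suc m) ∎
    where
    t = binomialTerm x y (suc m)
    first : t zero ≈ y ^ suc m
    first = begin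
      (suc m C 0) ·ℕ (1# * y ^ suc m)    ≈⟨ ×-congˡ (nC0≡1 (suc m)) ⟩
      1 ·ℕ (1# * y ^ suc m)              ≈⟨ ×-homo-1 _ ⟩
      1# * y ^ suc m                    ≈⟨ *-identityˡ _ ⟩
      y ^ suc m                         ∎
    top : ∀ {k j} → k ≡ suc m → j ≡ 0 → (suc m C k) ·ℕ (x ^ k * y ^ j) ≈ x ^ suc m
    top ≡.refl ≡.refl = begin
      (suc m C suc m) ·ℕ (x ^ suc m * 1#) ≈⟨ ×-congˡ (nCn≡1 (suc m)) ⟩
      1 ·ℕ (x ^ suc m * 1#)               ≈⟨ ×-homo-1 _ ⟩
      x ^ suc m * 1#                     ≈⟨ *-identityʳ _ ⟩
      x ^ suc m                          ∎
    last : t (suc (fromℕ m)) ≈ x ^ suc m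
    last = top (≡.cong suc (Fin.toℕ-fromℕ m))
      (≡.trans (≡.cong (m ℕ.∸_) (Fin.toℕ-fromℕ m)) (ℕ.n∸n≡0 m))

  -- Only the two outer terms of the binomial expansion survive. The hypothesis concerns the images
  -- of the binomial coefficients in the ring; for the exponent `q` it is supplied by
  -- `binomials-vanish`, which counts roots and does not mention the characteristic.
  ^-additive : ∀ m → (∀ (i : Fin m) → (suc m C suc (toℕ (inject₁ i))) ·ℕ 1# ≈ 0#) →
               ∀ x y → (x + y) ^ suc m ≈ x ^ suc m + y ^ suc m
  ^-additive m C≈0 x y = begin
    (x + y) ^ suc m                                    ≈⟨ binomial-split m x y ⟩
    y ^ suc m + (binomial-middle m x y + x ^ suc m)    ≈⟨ +-congˡ (+-congʳ middle≈0) ⟩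
    y ^ suc m + (0# + x ^ suc m)                       ≈⟨ +-congˡ (+-identityˡ _) ⟩
    y ^ suc m + x ^ suc m                              ≈⟨ +-comm _ _ ⟩
    x ^ suc m + y ^ suc m                              ∎
    where
    middle≈0 : binomial-middle m x y ≈ 0#
    middle≈0 = trans (sum-cong-≋ λ i → let k = suc m C suc (toℕ (inject₁ i))
                                           z = x ^ suc (toℕ (inject₁ i)) * y ^ (m ℕ.∸ toℕ (inject₁ i)) in begin
        k ·ℕ z            ≈⟨ ×-congʳ k (*-identityˡ z) ⟨
        k ·ℕ (1# * z)     ≈⟨ ×-assoc-* k 1# z ⟨
        (k ·ℕ 1#) * z     ≈⟨ *-congʳ (C≈0 i) ⟩
        0# * z           ≈⟨ zeroˡ z ⟩
        0#               ∎)
      (sum-replicate-zero m)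

-- The Frobenius map on polynomials over a finite field.

module Frobenius {c ℓ} (F : CommutativeRing c ℓ) (isField : IsField F)
                 {q : ℕ} (finite : CommutativeRing.setoid F HasCardinality q) where
  private module F = CommutativeRing F
  open Fields F isField
  open FiniteFields F isField finite
  open FreshmansDream F
  open import Algebra.Properties.Semiring.Exp F.semiring
  open import Algebra.Properties.Semiring.Mult F.semiring renaming (_×_ to _·ℕ_)
  open import Algebra.Properties.Semiring.Sum F.semiring
  open import Algebra.Properties.Group F.+-group using (∙-cancelˡ; identityʳ-unique)
  open import Relation.Binary.Reasoning.Setoid F.setoid

  eval-tabulate : ∀ {m} (a : Fin m → F.Carrier) x →
                  eval (tabulate a) x F.≈ ∑[ i < m ] (a i F.* x ^ toℕ i)
  eval-tabulate {zero}  a x = F.refl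
  eval-tabulate {suc m} a x = F.+-cong (F.sym (F.*-identityʳ _)) (begin
    x F.* eval (tabulate (a ∘ suc)) x                        ≈⟨ F.*-congˡ (eval-tabulate (a ∘ suc) x) ⟩
    x F.* ∑[ i < m ] (a (suc i) F.* x ^ toℕ i)               ≈⟨ *-distribˡ-sum x (λ i → a (suc i) F.* x ^ toℕ i) ⟩
    ∑[ i < m ] (x F.* (a (suc i) F.* x ^ toℕ i))             ≈⟨ sum-cong-≋ {m} (λ i → x∙yz≈y∙xz x (a (suc i)) (x ^ toℕ i)) ⟩
    ∑[ i < m ] (a (suc i) F.* x ^ suc (toℕ i))               ∎)
    where open import Algebra.Properties.CommutativeSemigroup F.*-commutativeSemigroup using (x∙yz≈y∙xz)

  -- X ↦ (X+1)^q − X^q − 1 has degree below q but vanishes at all q elements of F.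
  binomials-vanish : ∀ {m} → q ≡ suc m → (i : Fin m) →
                     (suc m C suc (toℕ (inject₁ i))) ·ℕ F.1# F.≈ F.0#
  binomials-vanish {m} ≡.refl = All.tabulate⁻ (tail (too-many-roots (F.0# ∷ tabulate b) element
    element-injective (ℕ.≤-reflexive (≡.cong suc (List.length-tabulate b))) λ i → root (element i)))
    where
    b : Fin m → F.Carrier
    b i = (suc m C suc (toℕ (inject₁ i))) ·ℕ F.1#
    term : ∀ x (i : Fin m) → x F.* (b i F.* x ^ toℕ i) F.≈
           (suc m C suc (toℕ (inject₁ i))) ·ℕ (x ^ suc (toℕ (inject₁ i)) F.* F.1# ^ (m ℕ.∸ toℕ (inject₁ i)))
    term x i rewrite Fin.toℕ-inject₁ i = begin
      x F.* (k ·ℕ F.1# F.* x ^ toℕ i)    ≈⟨ F.*-congˡ (×-assoc-* k F.1# _) ⟩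
      x F.* k ·ℕ (F.1# F.* x ^ toℕ i)    ≈⟨ ×-comm-* k x _ ⟩
      k ·ℕ (x F.* (F.1# F.* x ^ toℕ i))
        ≈⟨ ×-congʳ k (F.*-congˡ (F.*-identityˡ _)) ⟩
      k ·ℕ (x ^ suc (toℕ i))            ≈⟨ ×-congʳ k (F.*-identityʳ _) ⟨
      k ·ℕ (x ^ suc (toℕ i) F.* F.1#)
        ≈⟨ ×-congʳ k (F.*-congˡ (1^ (m ℕ.∸ toℕ i))) ⟨
      k ·ℕ (x ^ suc (toℕ i) F.* F.1# ^ (m ℕ.∸ toℕ i)) ∎
      where
      k = suc m C suc (toℕ i)
      1^ : ∀ n → F.1# ^ n F.≈ F.1#
      1^ zero    = F.refl
      1^ (suc n) = F.trans (F.*-identityˡ _) (1^ n)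
    root : ∀ x → eval (F.0# ∷ tabulate b) x F.≈ F.0#
    root x = begin
      F.0# F.+ x F.* eval (tabulate b) x           ≈⟨ F.+-identityˡ _ ⟩
      x F.* eval (tabulate b) x                    ≈⟨ F.*-congˡ (eval-tabulate b x) ⟩
      x F.* ∑[ i < m ] (b i F.* x ^ toℕ i)         ≈⟨ *-distribˡ-sum x (λ i → b i F.* x ^ toℕ i) ⟩
      ∑[ i < m ] (x F.* (b i F.* x ^ toℕ i))       ≈⟨ sum-cong-≋ {m} (term x) ⟩
      binomial-middle m x F.1#                     ≈⟨ middle≈0 ⟩
      F.0#                                         ∎
      where
      middle≈0 : binomial-middle m x F.1# F.≈ F.0#
      middle≈0 = identityʳ-unique x _ (∙-cancelˡ F.1# _ _ (begin
        F.1# F.+ (x F.+ binomial-middle m x F.1#)   ≈⟨ F.+-congˡ (F.+-comm _ _) ⟩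
        F.1# F.+ (binomial-middle m x F.1# F.+ x)   ≈⟨ F.+-cong (fermat F.1#) (F.+-congˡ (fermat x)) ⟨
        F.1# ^ suc m F.+ (binomial-middle m x F.1# F.+ x ^ suc m)   ≈⟨ binomial-split m x F.1# ⟨
        (x F.+ F.1#) ^ suc m                        ≈⟨ fermat (x F.+ F.1#) ⟩
        x F.+ F.1#                                  ≈⟨ F.+-comm _ _ ⟩
        F.1# F.+ x                                  ∎))

  open Polynomials F public
  private module P = CommutativeRing polynomialRing
  open import Algebra.Properties.CommutativeSemiring.Exp P.commutativeSemiring
    using () renaming (_^_ to _^ₚ_; ^-congˡ to ^ₚ-congˡ; ^-assocʳ to ^ₚ-assocʳ; ^-distrib-* to ^ₚ-distrib-*) public
  open import Algebra.Properties.Semiring.Mult P.semiring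
    using () renaming (_×_ to _×ₚ_)

  const : F.Carrier → Poly
  const a = a ∷ []

  X : Poly
  X = F.0# ∷ F.1# ∷ []

  const-* : ∀ a f → const a *ₚ f ≈ₚ a · f
  const-* a f = P.trans (P.+-congˡ (0∷0 P.refl)) (P.+-identityʳ _)

  ∷-const+X* : ∀ a f → a ∷ f ≈ₚ const a +ₚ X *ₚ f
  ∷-const+X* a f = P.sym (P.trans (P.+-congˡ {const a}
    (P.trans (0∷-*ₚ (F.1# ∷ []) f) (∷-cong F.refl (P.*-identityˡ f))))
    (∷-cong (F.+-identityʳ a) P.refl))

  const-^ : ∀ a m → const a ^ₚ m ≈ₚ const (a ^ m)
  const-^ a zero    = P.refl
  const-^ a (suc m) = P.trans (P.*-congˡ {const a} (const-^ a m)) (const-* a _)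

  ×-const : ∀ m → (m ×ₚ P.1#) ≈ₚ const (m ·ℕ F.1#)
  ×-const zero    = P.sym (0∷0 P.refl)
  ×-const (suc m) = P.+-congˡ (×-const m)

  ^q-additive : ∀ f g → (f +ₚ g) ^ₚ q ≈ₚ f ^ₚ q +ₚ g ^ₚ q
  ^q-additive = go 2≤N ≡.refl
    where
    -- The parameter `q` cannot be matched against a successor, so an equal number `m` is matched
    -- instead.
    go : ∀ {m} → 2 ℕ.≤ m → q ≡ m → ∀ f g → (f +ₚ g) ^ₚ m ≈ₚ f ^ₚ m +ₚ g ^ₚ m
    go {suc m} _ q≡ = FreshmansDream.^-additive polynomialRing m λ i →
      P.trans (×-const (suc m C suc (toℕ (inject₁ i)))) (P.trans (∷-cong (binomials-vanish q≡ i) P.refl) (0∷0 P.refl))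

  ^q^-additive : ∀ k f g → (f +ₚ g) ^ₚ (q ℕ.^ k) ≈ₚ f ^ₚ (q ℕ.^ k) +ₚ g ^ₚ (q ℕ.^ k)
  ^q^-additive zero    f g = P.trans (P.*-identityʳ _)
    (P.sym (P.+-cong (P.*-identityʳ f) (P.*-identityʳ g)))
  ^q^-additive (suc k) f g = P.trans (P.sym (^ₚ-assocʳ (f +ₚ g) q (q ℕ.^ k)))
    (P.trans (^ₚ-congˡ (q ℕ.^ k) (^q-additive f g))
    (P.trans (^q^-additive k (f ^ₚ q) (g ^ₚ q))
    (P.+-cong (^ₚ-assocʳ f q (q ℕ.^ k)) (^ₚ-assocʳ g q (q ℕ.^ k)))))

  ^q^-const : ∀ k a → const a ^ₚ (q ℕ.^ k) ≈ₚ const a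
  ^q^-const k a = P.trans (const-^ a (q ℕ.^ k)) (∷-cong (go k) P.refl)
    where
    go : ∀ k → a ^ (q ℕ.^ k) F.≈ a
    go zero    = F.*-identityʳ a
    go (suc k) = F.trans (F.sym (^-assocʳ a q (q ℕ.^ k)))
      (F.trans (^-congˡ (q ℕ.^ k) (fermat a)) (go k))

  module _ (p : Poly) where
    open Congruences polynomialRing p
    private module Q = CommutativeRing quotientRing

    -- Raising to the power q^k is additive, multiplicative and the identity on constants, so if it
    -- fixes X it fixes every polynomial in X. The modulus is arbitrary: it will be an irreducible
    -- polynomial or the square of one.
    ^q^-fixes : ∀ k → X ^ₚ (q ℕ.^ k) ≡ₘ X → ∀ f → f ^ₚ (q ℕ.^ k) ≡ₘ f
    ^q^-fixes k X-fixed [] = ≈⇒≡ₘ (P.trans (^ₚ-congˡ (q ℕ.^ k) {[]} {const F.0#} (P.sym (0∷0 P.refl)))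
      (P.trans (^q^-const k F.0#) (0∷0 P.refl)))
    ^q^-fixes k X-fixed (a ∷ f) = Q.trans
      (≈⇒≡ₘ (P.trans (^ₚ-congˡ Q (∷-const+X* a f))
        (P.trans (^q^-additive k (const a) (X *ₚ f))
        (P.+-cong (^q^-const k a) (^ₚ-distrib-* X f Q)))))
      (Q.trans (Q.+-congˡ {const a} (Q.*-cong X-fixed (^q^-fixes k X-fixed f)))
        (≈⇒≡ₘ (P.sym (∷-const+X* a f))))
      where Q = q ℕ.^ k

-- Irreducible polynomials and their residue fields.

module IrreduciblePolynomials
  {c ℓ} (F : CommutativeRing c ℓ) (isField : IsField F)
  {q : ℕ} (finite : CommutativeRing.setoid F HasCardinality q) where

  private module F = CommutativeRing F
  open F using (0#; 1#)
  open IsField isField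
  open FiniteFields F isField finite
  open Frobenius F isField finite public
  module P = CommutativeRing polynomialRing
  open import Algebra.Properties.Ring P.ring using (-‿distribˡ-*)
  open import Algebra.Properties.Group P.+-group using (//-rightDividesʳ)
  open import Algebra.Properties.Semiring.Divisibility P.semiring
    using (_∣_; _,_; ∣ʳ-trans; ∣ʳ-refl) public

  finToFun-injective : ∀ {m n} {i j : Fin (n ℕ.^ m)} →
    (∀ k → finToFun {n} {m} i k ≡ finToFun {n} {m} j k) → i ≡ j
  finToFun-injective {m} {n} {i} {j} eq = ≡.trans (≡.sym (Fin.funToFin-finToFin {m} {n} i))
    (≡.trans (funToFin-cong eq) (Fin.funToFin-finToFin {m} {n} j))
    where
    funToFin-cong : ∀ {m n} {f g : Fin m → Fin n} → (∀ k → f k ≡ g k) → funToFin f ≡ funToFin g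
    funToFin-cong {zero}  eq = ≡.refl
    funToFin-cong {suc m} eq = ≡.cong₂ combine (eq zero) (funToFin-cong (eq ∘ suc))

  coef-tabulate-++ : ∀ d (s : ℕ → F.Carrier) t → (∀ i → s (d ℕ.+ i) F.≈ coef t i) →
                     ∀ i → s i F.≈ coef (tabulate {n = d} (s ∘ toℕ) ++ t) i
  coef-tabulate-++ zero    s t rest i       = rest i
  coef-tabulate-++ (suc d) s t rest zero    = F.refl
  coef-tabulate-++ (suc d) s t rest (suc i) = coef-tabulate-++ d (s ∘ suc) t rest i

  Deg<⇒≈tabulate : ∀ {d f} → Deg< d f → f ≈ₚ tabulate {n = d} (coef f ∘ toℕ)
  Deg<⇒≈tabulate {d} {f} f< = ≡.subst (f ≈ₚ_) (List.++-identityʳ _)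
    (mk≈ (coef-tabulate-++ d (coef f) [] λ i → vanish f< (d ℕ.+ i) (ℕ.m≤m+n d i)))

  coef-tabulate : ∀ {d} (v : Fin d → F.Carrier) i → coef (tabulate v) (toℕ i) ≡ v i
  coef-tabulate v zero    = ≡.refl
  coef-tabulate v (suc i) = coef-tabulate (v ∘ suc) i

  Deg<-tabulate : ∀ {d} (v : Fin d → F.Carrier) → Deg< d (tabulate v)
  Deg<-tabulate {zero}  v = mk< λ _ _ → F.refl
  Deg<-tabulate {suc d} v = Deg<-∷ (v zero) (Deg<-tabulate (v ∘ suc))

  tabulate-cong : ∀ {d} {v w : Fin d → F.Carrier} → (∀ i → v i F.≈ w i) → tabulate v ≈ₚ tabulate w
  tabulate-cong {zero}  v≈w = P.refl
  tabulate-cong {suc d} v≈w = ∷-cong (v≈w zero) (tabulate-cong (v≈w ∘ suc))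

  Deg<-length : ∀ f → Deg< (length f) f
  Deg<-length []      = mk< λ _ _ → F.refl
  Deg<-length (a ∷ f) = Deg<-∷ a (Deg<-length f)

  Monic-≉0 : ∀ {d f} → Monic d f → ¬ f ≈ₚ []
  Monic-≉0 mf f≈0 = 0≉1 (F.trans (F.sym (at f≈0 _)) (leading mf))

  -- Equality in the finite field is decidable, so the highest nonzero coefficient is found by
  -- descending from `e`; its inverse is the scalar that makes `r` monic.
  normalise : ∀ e {r} → Deg< e r → r ≈ₚ [] ⊎ ∃₂ λ e′ a → e′ ℕ.< e × Monic e′ (a · r)
  normalise zero    r< = inj₁ (Deg<-0 r<)
  normalise (suc e) {r} r< with coef r e ≟ 0#
  ... | no c≉0  = let a , ac≈1 , _ = ≉0⇒invertible _ c≉0 in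
    inj₂ (e , a , ℕ.n<1+n e , record { leading = F.trans (coef-· a r e) ac≈1 ; above = Deg<-· a r< })
  ... | yes c≈0 with normalise e (mk< λ i e≤i → vanish′ i (ℕ.m≤n⇒m<n∨m≡n e≤i))
    where
    vanish′ : ∀ i → e ℕ.< i ⊎ e ≡ i → coef r i F.≈ 0#
    vanish′ i (inj₁ e<i)    = vanish r< i e<i
    vanish′ i (inj₂ ≡.refl) = c≈0
  ... | inj₁ r≈0                  = inj₁ r≈0
  ... | inj₂ (e′ , a , e′<e , mr) = inj₂ (e′ , a , ℕ.m≤n⇒m≤1+n e′<e , mr)

  -- Over a field every nonzero divisor can be scaled to a monic one, so excluding monic divisors of
  -- degree strictly between 0 and `d` is the usual irreducibility.
  record Irreducible (d : ℕ) (p : Poly) : Set (c ⊔ ℓ) where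
    field
      monic       : Monic d p
      nonconstant : 1 ℕ.≤ d
      minimal     : ∀ {e h} → 1 ℕ.≤ e → e ℕ.< d → Monic e h → ¬ h ∣ p

  module _ {d p} (mp : Monic d p) where
    open Congruences polynomialRing p

    -- The difference is a multiple of `p` of degree below `d`, hence zero by `multiple-small⇒0`.
    small-≡ₘ⇒≈ : ∀ {f g} → Deg< d f → Deg< d g → f ≡ₘ g → f ≈ₚ g
    small-≡ₘ⇒≈ {f} {g} f< g< (mod u f≈g+up) = P.trans f≈g+up
      (P.trans (P.+-congˡ {g} (P.*-congʳ {p} (multiple-small⇒0 mp u up<))) (P.+-identityʳ g))
      where
      neg< : Deg< d (-ₚ g)
      neg< = mk< λ i d≤i → F.trans (coef-neg g i)
        (F.trans (F.-‿cong (vanish g< i d≤i)) -0#≈0#)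
        where open import Algebra.Properties.Ring F.ring using (-0#≈0#)
      up< : Deg< d (u *ₚ p)
      up< = Deg<-resp (P.trans (P.+-congʳ { -ₚ g} f≈g+up)
        (P.trans (P.+-congʳ { -ₚ g} (P.+-comm g (u *ₚ p))) (//-rightDividesʳ g (u *ₚ p)))) (Deg<-+ f< neg<)

  module ResidueField {d p} (irr : Irreducible d p) where
    open Irreducible irr
    open Congruences polynomialRing p public
    module K = CommutativeRing quotientRing
    open import Relation.Binary.Reasoning.Setoid K.setoid

    p≡0 : p ≡ₘ []
    p≡0 = mod P.1# (P.sym (P.*-identityˡ p))

    -- A Euclidean descent that always divides `p`: from p = u r + r′ one has -u r ≡ r′, so an
    -- inverse of the scaled `r′` yields one of `r`. The remainder is nonzero, since otherwise `r`
    -- would be a proper divisor of `p`. The number `n` bounds the degree and drives the recursion.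
    monic-inverse : ∀ n {e r} → e ℕ.< n → e ℕ.< d → Monic e r → ∃ λ s → s *ₚ r ≡ₘ P.1#
    monic-inverse (suc n) {zero} {r} _ _ mr = P.1# , ≈⇒≡ₘ (P.trans (P.*-identityˡ r)
      (mk≈ λ { zero → leading mr ; (suc i) → vanish (above mr) (suc i) (s≤s z≤n) }))
    monic-inverse (suc n) {e@(suc _)} {r} (s≤s e≤n) e<d mr with division mr p
    ... | u , r′ , p≈ur+r′ , r′< with normalise e r′<
    ... | inj₁ r′≈0 = contradiction
      (u , P.sym (P.trans p≈ur+r′ (P.trans (P.+-congˡ {u *ₚ r} r′≈0) (P.+-identityʳ _))))
      (minimal (s≤s z≤n) e<d mr)
    ... | inj₂ (e′ , a , e′<e , mr′)
        with monic-inverse n (ℕ.<-≤-trans e′<e e≤n) (ℕ.<-trans e′<e e<d) mr′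
    ... | s , s[ar′]≡1 = s *ₚ const a *ₚ -ₚ u , (begin
      s *ₚ const a *ₚ -ₚ u *ₚ r      ≈⟨ K.*-assoc (s *ₚ const a) (-ₚ u) r ⟩
      s *ₚ const a *ₚ (-ₚ u *ₚ r)    ≈⟨ ≡ₘ-*-cong (K.refl {s *ₚ const a}) -ur≡r′ ⟩
      s *ₚ const a *ₚ r′             ≈⟨ K.*-assoc s (const a) r′ ⟩
      s *ₚ (const a *ₚ r′)           ≈⟨ ≡ₘ-*-cong (K.refl {s}) (≈⇒≡ₘ (const-* a r′)) ⟩
      s *ₚ (a · r′)                  ≈⟨ s[ar′]≡1 ⟩
      P.1#                           ∎)
      where
      -ur≡r′ : -ₚ u *ₚ r ≡ₘ r′
      -ur≡r′ = begin
        -ₚ u *ₚ r                      ≈⟨ ≈⇒≡ₘ (-‿distribˡ-* u r) ⟨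
        -ₚ (u *ₚ r)                    ≈⟨ K.+-identityˡ _ ⟨
        [] +ₚ -ₚ (u *ₚ r)              ≈⟨ ≡ₘ-+-cong p≡0 (K.refl { -ₚ (u *ₚ r)}) ⟨
        p +ₚ -ₚ (u *ₚ r)               ≈⟨ ≈⇒≡ₘ (P.+-congʳ { -ₚ (u *ₚ r)} (P.trans p≈ur+r′ (P.+-comm (u *ₚ r) r′))) ⟩
        (r′ +ₚ u *ₚ r) +ₚ -ₚ (u *ₚ r)  ≈⟨ ≈⇒≡ₘ (//-rightDividesʳ (u *ₚ r) r′) ⟩
        r′                             ∎

    residue : ∀ f → ∃ λ r → f ≡ₘ r × Deg< d r
    residue f = let u , r , f≈up+r , r< = division monic f in
      r , mod u (P.trans f≈up+r (P.+-comm (u *ₚ p) r)) , r<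

    K-isField : IsField quotientRing
    K-isField = record
      { 0≉1 = λ 0≡1 → 0≉1 (at (small-≡ₘ⇒≈ monic (mk< λ _ _ → F.refl) 1< 0≡1) 0)
      ; ≉0⇒invertible = invert
      }
      where
      1< : Deg< d P.1#
      1< = Deg<-weaken nonconstant (Deg<-length P.1#)
      invert : ∀ f → ¬ f ≡ₘ [] → ∃ λ g → g *ₚ f ≡ₘ P.1# × f *ₚ g ≡ₘ P.1#
      invert f f≢0 with residue f
      ... | r , f≡r , r< with normalise d r<
      ... | inj₁ r≈0 = contradiction (K.trans f≡r (≈⇒≡ₘ r≈0)) f≢0
      ... | inj₂ (e , a , e<d , mr) with monic-inverse (suc e) ℕ.≤-refl e<d mr
      ... | s , s[ar]≡1 = s *ₚ const a , left , K.trans (K.*-comm f _) left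
        where
        left : s *ₚ const a *ₚ f ≡ₘ P.1#
        left = begin
          s *ₚ const a *ₚ f       ≈⟨ K.*-assoc s (const a) f ⟩
          s *ₚ (const a *ₚ f)     ≈⟨ ≡ₘ-*-cong (K.refl {s}) (≡ₘ-*-cong (K.refl {const a}) f≡r) ⟩
          s *ₚ (const a *ₚ r)     ≈⟨ ≡ₘ-*-cong (K.refl {s}) (≈⇒≡ₘ (const-* a r)) ⟩
          s *ₚ (a · r)            ≈⟨ s[ar]≡1 ⟩
          P.1#                    ∎

    toVector : Poly → Fin d → F.Carrier
    toVector f i = coef (proj₁ (residue f)) (toℕ i)

    tabulate-toVector : ∀ f → tabulate (toVector f) ≡ₘ f
    tabulate-toVector f = let r , f≡r , r< = residue f in
      K.trans (≈⇒≡ₘ (P.sym (Deg<⇒≈tabulate r<))) (K.sym f≡r)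

    tabulate-injective : ∀ {v w : Fin d → F.Carrier} → tabulate v ≡ₘ tabulate w → ∀ i → v i F.≈ w i
    tabulate-injective {v} {w} v≡w i = ≡.subst₂ F._≈_ (coef-tabulate v i) (coef-tabulate w i)
      (at (small-≡ₘ⇒≈ monic (Deg<-tabulate v) (Deg<-tabulate w) v≡w) (toℕ i))

    -- Each class has exactly one representative of degree below `d`, and its `d` coefficients are
    -- arbitrary.
    K-finite : K.setoid HasCardinality (q ℕ.^ d)
    K-finite = record
      { to        = to
      ; cong      = λ { ≡.refl → K.refl }
      ; bijective = (λ eq → finToFun-injective {d} (λ k → element-injective (tabulate-injective eq k)))
                  , λ f → funToFin (index ∘ toVector f) , λ { ≡.refl → surj f }
      }
      where
      to : Fin (q ℕ.^ d) → Poly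
      to i = tabulate (λ k → element (finToFun {q} {d} i k))
      surj : ∀ f → to (funToFin (index ∘ toVector f)) ≡ₘ f
      surj f = K.trans (≈⇒≡ₘ (tabulate-cong λ k → F.trans
          (F.reflexive (≡.cong element (Fin.finToFun-funToFin (index ∘ toVector f) k)))
          (element-index (toVector f k))))
        (tabulate-toVector f)

    open FiniteFields quotientRing K-isField K-finite
      using () renaming (element to elementK; element-injective to elementK-injective; fermat to fermatK)
    open Fields quotientRing K-isField using (fixed-by-power⇒≤)

    open import Algebra.Properties.Semiring.Exp K.semiring
      using () renaming (_^_ to _^ₖ_; ^-congˡ to ^ₖ-congˡ)

    ^ₖ≡^ₚ : ∀ f n → f ^ₖ n ≡ f ^ₚ n
    ^ₖ≡^ₚ f zero    = ≡.refl
    ^ₖ≡^ₚ f (suc n) = ≡.cong (f *ₚ_) (^ₖ≡^ₚ f n)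

    q^-cancel-≤ : ∀ {m n} → q ℕ.^ m ℕ.≤ q ℕ.^ n → m ℕ.≤ n
    q^-cancel-≤ q^m≤q^n = ℕ.≮⇒≥ λ n<m → ℕ.<⇒≱ (ℕ.^-monoʳ-< q 2≤N n<m) q^m≤q^n

    -- All q^d residue classes are then roots of X^(q^m) - X, which forces q^d ≤ q^m.
    fixed⇒≤ : ∀ {m} → 1 ℕ.≤ m → (∀ f → f ^ₚ (q ℕ.^ m) ≡ₘ f) → d ℕ.≤ m
    fixed⇒≤ {m} 1≤m fixed = q^-cancel-≤ (fixed-by-power⇒≤
      (ℕ.≤-trans 2≤N (≡.subst (ℕ._≤ q ℕ.^ m) (ℕ.*-identityʳ q) (ℕ.^-monoʳ-≤ q {{ℕ.>-nonZero (ℕ.<⇒≤ 2≤N)}} 1≤m)))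
      elementK elementK-injective (λ i → K.trans (K.reflexive (^ₖ≡^ₚ (elementK i) (q ℕ.^ m))) (fixed (elementK i))))

    -- By `^q^-fixes` the power q^n acts trivially on the residue field, so `d ≤ n`. If `d < n`, the
    -- power q^d, which acts trivially by Fermat, can be split off; the power q^(n - d) is then
    -- trivial too, and d ≤ n - d.
    irreducible-degree : ∀ {n} → 1 ℕ.≤ n → X ^ₚ (q ℕ.^ n) ≡ₘ X → d ≡ n ⊎ d ℕ.+ d ℕ.≤ n
    irreducible-degree {n} 1≤n X-fixed =
      compare (ℕ.m≤n⇒m<n∨m≡n (fixed⇒≤ 1≤n (^q^-fixes p n X-fixed)))
      where
      k = n ℕ.∸ d
      n≡d+k : d ℕ.< n → d ℕ.+ k ≡ n
      n≡d+k d<n = ℕ.m+[n∸m]≡n (ℕ.<⇒≤ d<n)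
      fixed : d ℕ.< n → ∀ f → f ^ₚ (q ℕ.^ k) ≡ₘ f
      fixed d<n f = begin
        f ^ₚ (q ℕ.^ k)                  ≡⟨ ^ₖ≡^ₚ f (q ℕ.^ k) ⟨
        f ^ₖ (q ℕ.^ k)                  ≈⟨ ^ₖ-congˡ (q ℕ.^ k) (fermatK f) ⟨
        (f ^ₖ (q ℕ.^ d)) ^ₖ (q ℕ.^ k)   ≡⟨ ≡.trans (^ₖ≡^ₚ _ (q ℕ.^ k)) (≡.cong (_^ₚ (q ℕ.^ k)) (^ₖ≡^ₚ f (q ℕ.^ d))) ⟩
        (f ^ₚ (q ℕ.^ d)) ^ₚ (q ℕ.^ k)   ≈⟨ ≈⇒≡ₘ (^ₚ-assocʳ f (q ℕ.^ d) (q ℕ.^ k)) ⟩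
        f ^ₚ (q ℕ.^ d ℕ.* q ℕ.^ k)      ≡⟨ ≡.cong (f ^ₚ_) (ℕ.^-distribˡ-+-* q d k) ⟨
        f ^ₚ (q ℕ.^ (d ℕ.+ k))          ≡⟨ ≡.cong (λ m → f ^ₚ (q ℕ.^ m)) (n≡d+k d<n) ⟩
        f ^ₚ (q ℕ.^ n)                  ≈⟨ ^q^-fixes p n X-fixed f ⟩
        f                               ∎
      compare : d ℕ.< n ⊎ d ≡ n → d ≡ n ⊎ d ℕ.+ d ℕ.≤ n
      compare (inj₂ d≡n) = inj₁ d≡n
      compare (inj₁ d<n) = inj₂ (≡.subst (d ℕ.+ d ℕ.≤_) (n≡d+k d<n)
        (ℕ.+-monoʳ-≤ d (fixed⇒≤ (ℕ.m<n⇒0<n∸m d<n) (fixed d<n))))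

-- The total degree of all monic polynomials of degree between 1 and m, and its estimate.

sum-powers : ℕ → ℕ → ℕ
sum-powers q zero    = 0
sum-powers q (suc m) = q ℕ.^ suc m ℕ.* suc m ℕ.+ sum-powers q m

m<q^m : ∀ {q} → 2 ℕ.≤ q → ∀ m → m ℕ.< q ℕ.^ m
m<q^m {q} 2≤q zero    = s≤s z≤n
m<q^m {q} 2≤q (suc m) = begin-strict
  suc m                  ≤⟨ m<q^m 2≤q m ⟩
  q ℕ.^ m                <⟨ ℕ.^-monoʳ-< q 2≤q (ℕ.n<1+n m) ⟩
  q ℕ.^ suc m            ∎
  where open ℕ.≤-Reasoning

-- By `m<q^m` the top summand is at most q^(2m + 1), and the rest is below q^(2m) by induction. The
-- sum is below 2 q^(2m + 1), which is at most q^(2m + 2).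
sum-powers-bound : ∀ {q} → 2 ℕ.≤ q → ∀ m → sum-powers q m ℕ.< q ℕ.^ (m ℕ.+ m)
sum-powers-bound {q} 2≤q zero    = s≤s z≤n
sum-powers-bound {q} 2≤q (suc m) = begin-strict
  q ℕ.^ suc m ℕ.* suc m ℕ.+ sum-powers q m
    <⟨ ℕ.+-mono-≤-< (ℕ.*-monoʳ-≤ (q ℕ.^ suc m) (m<q^m 2≤q m)) (sum-powers-bound 2≤q m) ⟩
  q ℕ.^ suc m ℕ.* q ℕ.^ m ℕ.+ q ℕ.^ (m ℕ.+ m)
    ≡⟨ ≡.cong (ℕ._+ q ℕ.^ (m ℕ.+ m)) (ℕ.^-distribˡ-+-* q (suc m) m) ⟨
  q ℕ.^ suc (m ℕ.+ m) ℕ.+ q ℕ.^ (m ℕ.+ m)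
    ≤⟨ ℕ.+-monoʳ-≤ _ (ℕ.^-monoʳ-≤ q {{ℕ.>-nonZero (ℕ.<⇒≤ 2≤q)}} (ℕ.n≤1+n (m ℕ.+ m))) ⟩
  q ℕ.^ suc (m ℕ.+ m) ℕ.+ q ℕ.^ suc (m ℕ.+ m)
    ≡⟨ ≡.cong (q ℕ.^ suc (m ℕ.+ m) ℕ.+_) (ℕ.+-identityʳ _) ⟨
  2 ℕ.* q ℕ.^ suc (m ℕ.+ m)
    ≤⟨ ℕ.*-monoˡ-≤ (q ℕ.^ suc (m ℕ.+ m)) 2≤q ⟩
  q ℕ.* q ℕ.^ suc (m ℕ.+ m)
    ≡⟨ ≡.cong (λ k → q ℕ.^ suc k) (ℕ.+-suc m m) ⟨
  q ℕ.^ (suc m ℕ.+ suc m) ∎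
  where open ℕ.≤-Reasoning

sum-tabulate-const : ∀ n k → ListAction.sum (tabulate {n = n} (λ _ → k)) ≡ n ℕ.* k
sum-tabulate-const zero    k = ≡.refl
sum-tabulate-const (suc n) k = ≡.cong (k ℕ.+_) (sum-tabulate-const n k)

-- Existence of irreducible polynomials of every positive degree.

module IrreducibleExistence
  {c ℓ} (F : CommutativeRing c ℓ) (isField : IsField F)
  {q : ℕ} (finite : CommutativeRing.setoid F HasCardinality q) where

  private module F = CommutativeRing F
  open F using (0#; 1#)
  open FiniteFields F isField finite
  open IsField isField
  open IrreduciblePolynomials F isField finite public
  open import Algebra.Properties.Group P.+-group using (//-rightDividesˡ)

  -- Modulo the square of `p`, the power q^n fixes `p`, yet it sends `p` to 0 because the exponent
  -- is at least 2. So `p` would be a multiple of its own square, which has twice its degree.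
  not-squarefree⇒⊥ : ∀ {n d p} → 1 ℕ.≤ n → Irreducible d p →
    Congruences._≡ₘ_ polynomialRing (p *ₚ p) (X ^ₚ (q ℕ.^ n)) X → ⊥
  not-squarefree⇒⊥ {n} {d} {p} 1≤n irr X-fixed = Monic-≉0 monic (small-≡ₘ⇒≈ (Monic-* monic monic)
    (mk< λ i d+d≤i → vanish (above monic) i (ℕ.<-≤-trans (ℕ.m<n+m d nonconstant) d+d≤i))
    (mk< λ _ _ → F.refl)
    (≡ₘ-trans (≡ₘ-sym (^q^-fixes (p *ₚ p) n X-fixed p)) (p^ 2≤q^n)))
    where
    open Irreducible irr
    open Congruences polynomialRing (p *ₚ p)
    2≤q^n : 2 ℕ.≤ q ℕ.^ n
    2≤q^n = ℕ.≤-trans 2≤N (≡.subst (ℕ._≤ q ℕ.^ n) (ℕ.*-identityʳ q)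
      (ℕ.^-monoʳ-≤ q {{ℕ.>-nonZero (ℕ.<⇒≤ 2≤N)}} 1≤n))
    p^ : ∀ {k} → 2 ℕ.≤ k → p ^ₚ k ≡ₘ []
    p^ {suc (suc k)} (s≤s (s≤s _)) = mod (p ^ₚ k) (P.trans (P.sym (P.*-assoc p p (p ^ₚ k)))
      (P.*-comm (p *ₚ p) (p ^ₚ k)))

  -- Stated negatively because producing a factor would require a search.
  no-irreducible-factor⇒⊥ : ∀ n {d g} → d ℕ.< n → 1 ℕ.≤ d → Monic d g →
    (∀ {e p} → Irreducible e p → p ∣ g → ⊥) → ⊥
  no-irreducible-factor⇒⊥ (suc n) {d} {g} (s≤s d≤n) 1≤d mg none = none {d} {g} (record
    { monic = mg
    ; nonconstant = 1≤d
    ; minimal = λ 1≤e e<d mh h∣g → no-irreducible-factor⇒⊥ n (ℕ.<-≤-trans e<d d≤n) 1≤e mh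
        λ irr p∣h → none irr (∣ʳ-trans p∣h h∣g)
    }) ∣ʳ-refl

  -- Scale `u` to a monic `a · u` of degree `k′`. Then `a · e` is monic of degree k′ + d and has
  -- coefficient `a` at `k`. If k′ + d < k then a = 0, and if k < k′ + d then 1 = 0; so the degrees
  -- agree and a = 1.
  Monic-quotient : ∀ {d k h e u} → Monic d h → Monic k e → u *ₚ h ≈ₚ e →
                   ∃ λ k′ → Monic k′ u × k′ ℕ.+ d ≡ k
  Monic-quotient {d} {k} {h} {e} {u} mh me uh≈e with normalise (length u) (Deg<-length u)
  ... | inj₁ u≈0 = contradiction (P.trans (P.sym uh≈e) (P.*-congʳ {h} u≈0)) (Monic-≉0 me)
  ... | inj₂ (k′ , a , _ , mau) = by-degree (ℕ.<-cmp (k′ ℕ.+ d) k)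
    where
    mae : Monic (k′ ℕ.+ d) (a · e)
    mae = Monic-resp (P.trans (·-*ₚ-assoc a u h) (·-cong F.refl uh≈e)) (Monic-* mau mh)
    coef-ae : coef (a · e) k F.≈ a
    coef-ae = F.trans (coef-· a e k) (F.trans (F.*-congˡ (leading me)) (F.*-identityʳ a))
    by-degree : _ → _
    by-degree (tri< k′+d<k _ _) = contradiction
      (P.trans (·-cong a≈0 P.refl) (·-zero u)) (Monic-≉0 mau)
      where
      a≈0 : a F.≈ 0#
      a≈0 = F.trans (F.sym coef-ae) (vanish (above mae) k k′+d<k)
    by-degree (tri≈ _ ≡.refl _) = k′ , Monic-resp (P.trans (·-cong a≈1 P.refl) (·-identity u)) mau , ≡.refl
      where
      a≈1 : a F.≈ 1#
      a≈1 = F.trans (F.sym coef-ae) (leading mae)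
    by-degree (tri> _ _ k<k′+d) = contradiction
      (F.trans (F.sym (vanish (Deg<-· a (above me)) (k′ ℕ.+ d) k<k′+d)) (leading mae)) 0≉1

  Listed : ℕ → Poly → List (ℕ × Poly) → Set (c ⊔ ℓ)
  Listed d p = Any (λ dh → d ≡ proj₁ dh × p ≈ₚ proj₂ dh)

  module _ {g} (squarefree : ∀ {d p} → Irreducible d p → p *ₚ p ∣ g → ⊥) where

    -- Each entry of `hs` is discarded or divided out of `e` once; as `g` is squarefree, the
    -- remaining entries still list all irreducible factors of what is left. At the end of the list
    -- no irreducible factor remains, so the degree is 0. Whether an entry is an irreducible factor
    -- is settled by excluded middle under a double negation, the inequality being decidable.
    degree-bound : ∀ hs {k e} → Monic k e → e ∣ g →
      (∀ {d p} → Irreducible d p → p ∣ e → Listed d p hs) → k ℕ.≤ ListAction.sum (map proj₁ hs)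
    degree-bound [] {zero}  me e∣g listed = z≤n
    degree-bound [] {suc k} me e∣g listed = contradiction {A = ⊥}
      (no-irreducible-factor⇒⊥ _ ℕ.≤-refl (s≤s z≤n) me (λ irr p∣e → empty (listed irr p∣e))) λ ()
      where
      empty : ∀ {d p} → Listed d p [] → ⊥
      empty ()
    degree-bound ((d , h) ∷ hs) {k} {e} me e∣g listed =
      decidable-stable (k ℕ.≤? _) λ k≰ → ¬¬-excluded-middle λ
        { (yes h-factor) → k≰ (factor h-factor)
        ; (no ¬h-factor) → k≰ (ℕ.≤-trans (degree-bound hs me e∣g (not-factor ¬h-factor)) (ℕ.m≤n+m _ d))
        }
      where
      h-Factor = ∃[ p ] (Irreducible d p × p ≈ₚ h × p ∣ e)

      not-factor : ¬ h-Factor → ∀ {d p} → Irreducible d p → p ∣ e → Listed d p hs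
      not-factor ¬h-factor irr p∣e with listed irr p∣e
      ... | here (≡.refl , p≈h) = contradiction (_ , irr , p≈h , p∣e) ¬h-factor
      ... | there p∈hs          = p∈hs

      factor : h-Factor → k ℕ.≤ d ℕ.+ ListAction.sum (map proj₁ hs)
      factor (p , irr , p≈h , u , up≈e) with Monic-quotient {u = u} (Irreducible.monic irr) me up≈e
      ... | k′ , mu , ≡.refl = ≡.subst (ℕ._≤ d ℕ.+ ListAction.sum (map proj₁ hs)) (ℕ.+-comm d k′)
        (ℕ.+-monoʳ-≤ d (degree-bound hs mu (∣ʳ-trans (p , P.trans (P.*-comm p u) up≈e) e∣g) listed′))
        where
        listed′ : ∀ {d′ p′} → Irreducible d′ p′ → p′ ∣ u → Listed d′ p′ hs
        listed′ {p′ = p′} irr′ (v , vp′≈u) with listed irr′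
          (p *ₚ v , P.trans (P.*-assoc p v p′) (P.trans (P.*-congˡ {p} vp′≈u) (P.trans (P.*-comm p u) up≈e)))
        ... | there p′∈hs          = p′∈hs
        -- Here `p′` equals `p`, and since it divides `u`, the square of `p` would divide `e` and
        -- hence `g`.
        ... | here (≡.refl , p′≈h) = contradiction {A = ⊥} (squarefree irr (∣ʳ-trans
          (v , P.trans (P.sym (P.*-assoc v p p)) (P.trans (P.*-congʳ {p}
            (P.trans (P.*-congˡ {v} (P.trans p≈h (P.sym p′≈h))) vp′≈u)) up≈e)) e∣g)) λ ()

  monics : ℕ → List (ℕ × Poly)
  monics zero    = []
  monics (suc m) = tabulate {n = q ℕ.^ suc m}
    (λ i → suc m , tabulate (λ k → element (finToFun {q} {suc m} i k)) ++ 1# ∷ []) ++ monics m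

  sum-degrees-monics : ∀ m → ListAction.sum (map proj₁ (monics m)) ≡ sum-powers q m
  sum-degrees-monics zero    = ≡.refl
  sum-degrees-monics (suc m) = begin
    ListAction.sum (map proj₁ (tabulate ms ++ monics m))                ≡⟨ ≡.cong ListAction.sum (List.map-++ proj₁ (tabulate ms) (monics m)) ⟩
    ListAction.sum (map proj₁ (tabulate ms) ++ map proj₁ (monics m))    ≡⟨ ListAction.sum-++ (map proj₁ (tabulate ms)) _ ⟩
    ListAction.sum (map proj₁ (tabulate ms)) ℕ.+ ListAction.sum (map proj₁ (monics m))
      ≡⟨ ≡.cong₂ ℕ._+_ (≡.trans (≡.cong ListAction.sum (List.map-tabulate ms proj₁))
           (sum-tabulate-const (q ℕ.^ suc m) (suc m))) (sum-degrees-monics m) ⟩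
    sum-powers q (suc m) ∎
    where
    open ≡-Reasoning
    ms : Fin (q ℕ.^ suc m) → ℕ × Poly
    ms i = suc m , tabulate (λ k → element (finToFun {q} {suc m} i k)) ++ 1# ∷ []

  Monic⇒Listed : ∀ m {d p} → Monic d p → 1 ℕ.≤ d → d ℕ.≤ m → Listed d p (monics m)
  Monic⇒Listed zero    mp (s≤s _) ()
  Monic⇒Listed (suc m) {d} {p} mp 1≤d d≤1+m with ℕ.m≤n⇒m<n∨m≡n d≤1+m
  ... | inj₁ (s≤s d≤m) = Any.++⁺ʳ _ (Monic⇒Listed m mp 1≤d d≤m)
  ... | inj₂ ≡.refl    = Any.++⁺ˡ (Any.tabulate⁺ (funToFin (index ∘ v)) (≡.refl , mk≈ λ i →
      F.trans (coef-tabulate-++ d (coef p) (1# ∷ []) top i)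
        (append-cong (λ k → F.sym (F.trans
          (F.reflexive (≡.cong element (Fin.finToFun-funToFin (index ∘ v) k)))
          (element-index (v k)))) i)))
    where
    v : Fin d → F.Carrier
    v k = coef p (toℕ k)
    top : ∀ i → coef p (d ℕ.+ i) F.≈ coef (1# ∷ []) i
    top zero    = F.trans (F.reflexive (≡.cong (coef p) (ℕ.+-identityʳ d))) (leading mp)
    top (suc i) = vanish (above mp) (d ℕ.+ suc i) (ℕ.m<m+n d (s≤s z≤n))
    append-cong : ∀ {d t} {v w : Fin d → F.Carrier} → (∀ k → v k F.≈ w k) →
      ∀ i → coef (tabulate v ++ t) i F.≈ coef (tabulate w ++ t) i
    append-cong {zero}  v≈w i       = F.refl
    append-cong {suc d} v≈w zero    = v≈w zero
    append-cong {suc d} v≈w (suc i) = append-cong (v≈w ∘ suc) i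

  Monic-X^ : ∀ n → Monic n (X ^ₚ n)
  Monic-X^ zero    = record { leading = F.refl ; above = Deg<-length P.1# }
  Monic-X^ (suc n) = Monic-* {1} (record { leading = F.refl ; above = Deg<-length X }) (Monic-X^ n)

  irreducible-exists : ∀ {n} → 1 ℕ.≤ n → ¬ ¬ (∃[ p ] Irreducible n p)
  irreducible-exists {n} 1≤n none = ℕ.<-irrefl ≡.refl (begin-strict
    Q                                       ≤⟨ degree-bound squarefree (monics ⌊ n /2⌋) Monic-g ∣ʳ-refl listed ⟩
    ListAction.sum (map proj₁ (monics ⌊ n /2⌋))        ≡⟨ sum-degrees-monics ⌊ n /2⌋ ⟩
    sum-powers q ⌊ n /2⌋                    <⟨ sum-powers-bound 2≤N ⌊ n /2⌋ ⟩
    q ℕ.^ (⌊ n /2⌋ ℕ.+ ⌊ n /2⌋)             ≤⟨ ℕ.^-monoʳ-≤ q {{ℕ.>-nonZero (ℕ.<⇒≤ 2≤N)}} halves ⟩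
    Q                                       ∎)
    where
    open ℕ.≤-Reasoning
    Q = q ℕ.^ n
    g = X ^ₚ Q +ₚ -ₚ X

    halves : ⌊ n /2⌋ ℕ.+ ⌊ n /2⌋ ℕ.≤ n
    halves = ℕ.≤-trans (ℕ.+-monoʳ-≤ ⌊ n /2⌋ (ℕ.⌊n/2⌋≤⌈n/2⌉ n)) (ℕ.≤-reflexive (ℕ.⌊n/2⌋+⌈n/2⌉≡n n))

    2≤Q : 2 ℕ.≤ Q
    2≤Q = ℕ.≤-trans 2≤N (≡.subst (ℕ._≤ Q) (ℕ.*-identityʳ q)
      (ℕ.^-monoʳ-≤ q {{ℕ.>-nonZero (ℕ.<⇒≤ 2≤N)}} 1≤n))

    Monic-g : Monic Q g
    Monic-g = record
      { leading = F.trans (coef-+ (X ^ₚ Q) (-ₚ X) Q) (F.trans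
          (F.+-cong (leading (Monic-X^ Q)) (vanish (Deg<-length (-ₚ X)) Q 2≤Q)) (F.+-identityʳ 1#))
      ; above = Deg<-+ (above (Monic-X^ Q)) (Deg<-weaken (ℕ.m≤n⇒m≤1+n 2≤Q) (Deg<-length (-ₚ X)))
      }

    ∣g⇒X-fixed : ∀ {m} → m ∣ g → Congruences._≡ₘ_ polynomialRing m (X ^ₚ Q) X
    ∣g⇒X-fixed {m} (u , um≈g) = Congruences.mod u (P.sym (P.trans (P.+-congˡ {X} um≈g)
      (P.trans (P.+-comm X g) (//-rightDividesˡ X (X ^ₚ Q)))))

    squarefree : ∀ {d p} → Irreducible d p → p *ₚ p ∣ g → ⊥
    squarefree irr pp∣g = not-squarefree⇒⊥ 1≤n irr (∣g⇒X-fixed pp∣g)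

    listed : ∀ {d p} → Irreducible d p → p ∣ g → Listed d p (monics ⌊ n /2⌋)
    listed {d} {p} irr p∣g = by-degree (ResidueField.irreducible-degree irr 1≤n (∣g⇒X-fixed p∣g))
      where
      by-degree : d ≡ n ⊎ d ℕ.+ d ℕ.≤ n → Listed d p (monics ⌊ n /2⌋)
      -- Degree `n` is excluded by the assumption `none`; any other degree is at most n / 2 and
      -- occurs in the list.
      by-degree (inj₁ ≡.refl) = contradiction (p , irr) none
      by-degree (inj₂ d+d≤n)  = Monic⇒Listed ⌊ n /2⌋ (Irreducible.monic irr) (Irreducible.nonconstant irr)
        (≡.subst (ℕ._≤ ⌊ n /2⌋) (≡.sym (ℕ.n≡⌊n+n/2⌋ d)) (ℕ.⌊n/2⌋-mono d+d≤n))

-- Injective codes for nonsingular matrices.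

delete : ∀ {M} (z i : Fin M) → z ≢ i → Fin (M ℕ.∸ 1)
-- The bound is `M ∸ 1` because the powers of `q` to which this is applied are not successors by
-- form; the index `z` shows that `M` is positive.
delete {suc M} z i z≢i = punchOut z≢i

delete-injective : ∀ {M} (z : Fin M) {i j} (z≢i : z ≢ i) (z≢j : z ≢ j) →
                   delete z i z≢i ≡ delete z j z≢j → i ≡ j
delete-injective {suc M} z z≢i z≢j eq = Fin.punchOut-injective z≢i z≢j eq

-- The order of the general linear group of k × k matrices over a field with `q` elements. The
-- factors of the recursion count the nonzero first rows, the first coordinates of the ratios, and
-- the minors.
encodingSize : ℕ → ℕ → ℕ
encodingSize q zero    = 1
encodingSize q (suc k) = (q ℕ.^ suc k ℕ.∸ 1) ℕ.* (q ℕ.^ k ℕ.* encodingSize q k)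

module Counting
  {c ℓ} (F : CommutativeRing c ℓ) (isField : IsField F)
  {q : ℕ} (finite : CommutativeRing.setoid F HasCardinality q) where

  private module F = CommutativeRing F
  open F using (0#; 1#)
  open FiniteFields F isField finite
  open IsField isField
  open IrreducibleExistence F isField finite
  open LinearAlgebra F
  open import Algebra.Properties.Semiring.Sum F.semiring

  -- Linear independence of the rows. It stands for nonsingularity in the induction, since it passes
  -- to `minor` without an inverse matrix being constructed.
  Independent : ∀ {n} → Matrix n → Set (c ⊔ ℓ)
  Independent T = ∀ α → (α *ᵛ T) ≈ᵛ 0ᵛ → α ≈ᵛ 0ᵛ

  *ᵛ-1ᴹ : ∀ {n} (α : Fin n → F.Carrier) → (α *ᵛ 1ᴹ) ≈ᵛ α
  *ᵛ-1ᴹ {suc n} α j = begin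
    ∑[ i < suc n ] (α i F.* 1ᴹ i j)
      ≈⟨ sum-remove {i = j} (λ i → α i F.* 1ᴹ i j) ⟩
    α j F.* 1ᴹ j j F.+ ∑[ i < n ] (α (punchIn j i) F.* 1ᴹ (punchIn j i) j)
      ≈⟨ F.+-cong (F.trans (F.*-congˡ diagonal) (F.*-identityʳ _))
           (F.trans (sum-cong-≋ {n} λ i → F.trans (F.*-congˡ (off-diagonal (Fin.punchInᵢ≢i j i))) (F.zeroʳ _))
             (sum-replicate-zero n)) ⟩
    α j F.+ 0#        ≈⟨ F.+-identityʳ _ ⟩
    α j               ∎
    where
    open import Relation.Binary.Reasoning.Setoid F.setoid
    diagonal : 1ᴹ j j F.≈ 1#
    diagonal rewrite dec-true (j Fin.≟ j) ≡.refl = F.refl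
    off-diagonal : ∀ {i} → i ≢ j → 1ᴹ i j F.≈ 0#
    off-diagonal {i} i≢j rewrite dec-false (i Fin.≟ j) i≢j = F.refl

  *ᵛ-*ᴹ : ∀ {n} α (T S : Matrix n) → (α *ᵛ (T *ᴹ S)) ≈ᵛ ((α *ᵛ T) *ᵛ S)
  *ᵛ-*ᴹ {n} α T S j = begin
    ∑[ i < n ] (α i F.* ∑[ k < n ] (T i k F.* S k j))
      ≈⟨ sum-cong-≋ {n} (λ i → F.trans (*-distribˡ-sum (α i) (λ k → T i k F.* S k j))
           (sum-cong-≋ {n} λ k → F.sym (F.*-assoc (α i) (T i k) (S k j)))) ⟩
    ∑[ i < n ] ∑[ k < n ] (α i F.* T i k F.* S k j)
      ≈⟨ ∑-comm (λ i k → α i F.* T i k F.* S k j) ⟩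
    ∑[ k < n ] ∑[ i < n ] (α i F.* T i k F.* S k j)
      ≈⟨ sum-cong-≋ {n} (λ k → F.sym (*-distribʳ-sum (S k j) (λ i → α i F.* T i k))) ⟩
    ∑[ k < n ] ((α *ᵛ T) k F.* S k j) ∎
    where open import Relation.Binary.Reasoning.Setoid F.setoid

  GL⇒Independent : ∀ {n} {T : Matrix n} → GL n T → Independent T
  GL⇒Independent {n} {T} (S , _ , TS≈1) α αT≈0 j = begin
    α j                            ≈⟨ *ᵛ-1ᴹ α j ⟨
    (α *ᵛ 1ᴹ) j                    ≈⟨ sum-cong-≋ {n} (λ i → F.*-congˡ (TS≈1 i j)) ⟨
    (α *ᵛ (T *ᴹ S)) j              ≈⟨ *ᵛ-*ᴹ α T S j ⟩
    ((α *ᵛ T) *ᵛ S) j              ≈⟨ sum-cong-≋ {n} (λ k → F.trans (F.*-congʳ (αT≈0 k)) (F.zeroˡ _)) ⟩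
    ∑[ k < n ] 0#                  ≈⟨ sum-replicate-zero n ⟩
    0#                             ∎
    where open import Relation.Binary.Reasoning.Setoid F.setoid

  -- Row `i` of the identity matrix picks out row `i` of `T`.
  Independent⇒row≉0 : ∀ {n} {T : Matrix n} → Independent T → ∀ i → ¬ T i ≈ᵛ 0ᵛ
  Independent⇒row≉0 {n} {T} ind i Ti≈0 = 0≉1 (F.sym (F.trans (F.sym diagonal)
    (ind (1ᴹ i) unit-row i)))
    where
    diagonal : 1ᴹ i i F.≈ 1#
    diagonal rewrite dec-true (i Fin.≟ i) ≡.refl = F.refl
    unit-term : ∀ k j → 1ᴹ i k F.* T k j F.≈ 0#
    unit-term k j with i Fin.≟ k
    ... | yes ≡.refl = F.trans (F.*-identityˡ _) (Ti≈0 j)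
    ... | no _       = F.zeroˡ _
    unit-row : (1ᴹ i *ᵛ T) ≈ᵛ 0ᵛ
    unit-row j = F.trans (sum-cong-≋ {n} λ k → unit-term k j) (sum-replicate-zero n)

  encodeVector : ∀ {n} → (Fin n → F.Carrier) → Fin (q ℕ.^ n)
  encodeVector v = funToFin (index ∘ v)

  encodeVector-injective : ∀ {n} {v w : Fin n → F.Carrier} → encodeVector v ≡ encodeVector w → v ≈ᵛ w
  encodeVector-injective {v = v} {w} eq i = index-injective (≡.trans
    (≡.sym (Fin.finToFun-funToFin (index ∘ v) i))
    (≡.trans (≡.cong (λ c → finToFun c i) eq) (Fin.finToFun-funToFin (index ∘ w) i)))

  tabulate-0 : ∀ n → tabulate {n = n} (λ _ → 0#) ≈ₚ []
  tabulate-0 zero    = P.refl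
  tabulate-0 (suc n) = 0∷0 (tabulate-0 n)

  tabulate-+ : ∀ {n} (v w : Fin n → F.Carrier) →
               tabulate (λ i → v i F.+ w i) ≈ₚ tabulate v +ₚ tabulate w
  tabulate-+ {zero}  v w = P.refl
  tabulate-+ {suc n} v w = ∷-cong F.refl (tabulate-+ (v ∘ suc) (w ∘ suc))

  tabulate-* : ∀ {n} a (v : Fin n → F.Carrier) → tabulate (λ i → a F.* v i) ≈ₚ const a *ₚ tabulate v
  tabulate-* a v = P.trans (go v) (P.sym (const-* a (tabulate v)))
    where
    go : ∀ {n} (v : Fin n → F.Carrier) → tabulate (λ i → a F.* v i) ≈ₚ a · tabulate v
    go {zero}  v = P.refl
    go {suc n} v = ∷-cong F.refl (go (v ∘ suc))

  combination : ∀ {m} → (Fin m → F.Carrier) → (Fin m → Poly) → Poly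
  combination {zero}  α f = []
  combination {suc m} α f = const (α zero) *ₚ f zero +ₚ combination (α ∘ suc) (f ∘ suc)

  tabulate-combination : ∀ {m n} α (T : Fin m → Fin n → F.Carrier) →
    tabulate (λ j → ∑[ i < m ] (α i F.* T i j)) ≈ₚ combination α (λ i → tabulate (T i))
  tabulate-combination {zero}  {n} α T = tabulate-0 n
  tabulate-combination {suc m} {n} α T = P.trans
    (tabulate-+ (λ j → α zero F.* T zero j) (λ j → ∑[ i < m ] (α (suc i) F.* T (suc i) j)))
    (P.+-cong (tabulate-* (α zero) (T zero)) (tabulate-combination (α ∘ suc) (T ∘ suc)))

  -- Row ratios in the extension field.

  module RowQuotients {k p} (irr : Irreducible (suc k) p) where
    open ResidueField irr
    open import Relation.Binary.Reasoning.Setoid K.setoid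
    open FiniteFields quotientRing K-isField K-finite using () renaming (_≟_ to _≟ₖ_)
    open Fields quotientRing K-isField using (*-equalʳ⇒≈0)

    combination-cong : ∀ {m} (α : Fin m → F.Carrier) {f g : Fin m → Poly} →
      (∀ i → f i ≡ₘ g i) → combination α f ≡ₘ combination α g
    combination-cong {zero}  α f≡g = K.refl
    combination-cong {suc m} α f≡g = ≡ₘ-+-cong (≡ₘ-*-cong (K.refl {const (α zero)}) (f≡g zero))
      (combination-cong (α ∘ suc) (f≡g ∘ suc))

    combination-* : ∀ {m} (α : Fin m → F.Carrier) (f : Fin m → Poly) z →
      combination α (λ i → f i *ₚ z) ≡ₘ combination α f *ₚ z
    combination-* {zero}  α f z = K.refl
    combination-* {suc m} α f z = begin
      const (α zero) *ₚ (f zero *ₚ z) +ₚ combination (α ∘ suc) (λ i → f (suc i) *ₚ z)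
        ≈⟨ ≡ₘ-+-cong (K.sym (K.*-assoc (const (α zero)) (f zero) z)) (combination-* (α ∘ suc) (f ∘ suc) z) ⟩
      const (α zero) *ₚ f zero *ₚ z +ₚ combination (α ∘ suc) (f ∘ suc) *ₚ z
        ≈⟨ K.distribʳ z (const (α zero) *ₚ f zero) (combination (α ∘ suc) (f ∘ suc)) ⟨
      combination α f *ₚ z ∎

    tabulate≡0 : ∀ {v : Fin (suc k) → F.Carrier} → tabulate v ≡ₘ [] → v ≈ᵛ 0ᵛ
    tabulate≡0 v≡0 = tabulate-injective (K.trans v≡0 (≈⇒≡ₘ (P.sym (tabulate-0 (suc k)))))

    module Normalised (T : Matrix (suc k)) (T₀≉0 : ¬ T zero ≈ᵛ 0ᵛ) where

      row : Fin (suc k) → Poly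
      row i = tabulate (T i)

      private
        row₀⁻¹ : ∃ λ g → g *ₚ row zero ≡ₘ P.1# × row zero *ₚ g ≡ₘ P.1#
        row₀⁻¹ = IsField.≉0⇒invertible K-isField (row zero) (λ r≡0 → T₀≉0 (tabulate≡0 r≡0))

      -- The ratio of row 0 to itself is 1 and is left out, hence `Fin k`. The quotients are written
      -- as vectors over the base field so that they can be coded and cut down to a minor.
      ratio : Fin k → Fin (suc k) → F.Carrier
      ratio i = toVector (row (suc i) *ₚ proj₁ row₀⁻¹)

      row≡ratio* : ∀ i → row (suc i) ≡ₘ tabulate (ratio i) *ₚ row zero
      row≡ratio* i = begin
        row (suc i)                                    ≈⟨ K.*-identityʳ _ ⟨
        row (suc i) *ₚ P.1#                            ≈⟨ ≡ₘ-*-cong (K.refl {row (suc i)}) (proj₁ (proj₂ row₀⁻¹)) ⟨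
        row (suc i) *ₚ (proj₁ row₀⁻¹ *ₚ row zero)      ≈⟨ K.*-assoc (row (suc i)) (proj₁ row₀⁻¹) (row zero) ⟨
        row (suc i) *ₚ proj₁ row₀⁻¹ *ₚ row zero
          ≈⟨ ≡ₘ-*-cong (tabulate-toVector (row (suc i) *ₚ proj₁ row₀⁻¹)) (K.refl {row zero}) ⟨
        tabulate (ratio i) *ₚ row zero                 ∎

      -- The element y of the extension field with αT = y r₀, where r₀ is row 0; its summand
      -- `const (α zero)` comes from the ratio 1 of row 0 to itself.
      factor-row₀ : (Fin (suc k) → F.Carrier) → Poly
      factor-row₀ α = const (α zero) +ₚ tabulate (λ j → ∑[ i < k ] (α (suc i) F.* ratio i j))

      *ᵛ≡factor* : ∀ α → tabulate (α *ᵛ T) ≡ₘ factor-row₀ α *ₚ row zero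
      *ᵛ≡factor* α = begin
        tabulate (α *ᵛ T)
          ≈⟨ ≈⇒≡ₘ (tabulate-combination α T) ⟩
        α₀ *ₚ row zero +ₚ combination (α ∘ suc) (row ∘ suc)
          ≈⟨ ≡ₘ-+-cong (K.refl {α₀ *ₚ row zero}) (combination-cong (α ∘ suc) row≡ratio*) ⟩
        α₀ *ₚ row zero +ₚ combination (α ∘ suc) (λ i → tabulate (ratio i) *ₚ row zero)
          ≈⟨ ≡ₘ-+-cong (K.refl {α₀ *ₚ row zero}) (combination-* (α ∘ suc) (λ i → tabulate (ratio i)) (row zero)) ⟩
        α₀ *ₚ row zero +ₚ combination (α ∘ suc) (λ i → tabulate (ratio i)) *ₚ row zero
          ≈⟨ K.distribʳ (row zero) α₀ (combination (α ∘ suc) (λ i → tabulate (ratio i))) ⟨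
        (α₀ +ₚ combination (α ∘ suc) (λ i → tabulate (ratio i))) *ₚ row zero
          ≈⟨ ≈⇒≡ₘ (P.*-congʳ {row zero} (P.+-congˡ {α₀} (tabulate-combination (α ∘ suc) ratio))) ⟨
        factor-row₀ α *ₚ row zero ∎
        where α₀ = const (α zero)

      minor : Matrix k
      minor i j = ratio i (suc j)

      -- If α annihilates the minor, the combination of the ratios with weights α has only its
      -- constant coordinate `x` left. The weight -x on row 0, whose ratio is 1, cancels it, so `β`
      -- annihilates `T` and is zero by independence.
      minor-independent : Independent T → Independent minor
      minor-independent ind α α*minor≈0 i = ind β (tabulate≡0 (begin
        tabulate (β *ᵛ T)              ≈⟨ *ᵛ≡factor* β ⟩
        factor-row₀ β *ₚ row zero      ≈⟨ ≈⇒≡ₘ (P.*-congʳ {row zero} factor≈0) ⟩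
        [] *ₚ row zero                 ≡⟨⟩
        []                             ∎)) (suc i)
        where
        x = ∑[ i < k ] (α i F.* ratio i zero)
        β : Fin (suc k) → F.Carrier
        β zero    = F.- x
        β (suc i) = α i
        factor≈0 : factor-row₀ β ≈ₚ []
        factor≈0 = P.trans
          (∷-cong (F.-‿inverseˡ x) (P.trans (tabulate-cong α*minor≈0) (tabulate-0 k)))
          (0∷0 P.refl)

      -- The minor misses only the first coordinates of the `k` ratios, which cost the factor q^k.
      encodeRatios : ∀ {N} → Fin N → Fin (q ℕ.^ k ℕ.* N)
      encodeRatios minor-code = combine (encodeVector (λ i → ratio i zero)) minor-code

    module _ {T S : Matrix (suc k)} (T₀≉0 : ¬ T zero ≈ᵛ 0ᵛ) (S₀≉0 : ¬ S zero ≈ᵛ 0ᵛ) where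
      private
        module T = Normalised T T₀≉0
        module S = Normalised S S₀≉0

      module _ (ratio≈ : ∀ i → T.ratio i ≈ᵛ S.ratio i) where

        same-ratios : T zero ≈ᵛ S zero → T ≈ᴹ S
        same-ratios T₀≈S₀ zero    = T₀≈S₀
        same-ratios T₀≈S₀ (suc i) = tabulate-injective (begin
          T.row (suc i)                          ≈⟨ T.row≡ratio* i ⟩
          tabulate (T.ratio i) *ₚ T.row zero     ≈⟨ ≈⇒≡ₘ (P.*-cong (tabulate-cong (ratio≈ i)) (tabulate-cong T₀≈S₀)) ⟩
          tabulate (S.ratio i) *ₚ S.row zero     ≈⟨ S.row≡ratio* i ⟨
          S.row (suc i)                          ∎)

        -- With equal ratios, αT = y r₀ and αS = y s₀ for the same y, where r₀ and s₀ are the first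
        -- rows, so αT = αS forces y = 0 or r₀ = s₀.
        same-ratios-intersecting : Independent T →
          ∃[ α ] (¬ (α ≈ᵛ 0ᵛ) × (α *ᵛ T) ≈ᵛ (α *ᵛ S)) → T ≈ᴹ S
        same-ratios-intersecting ind (α , α≉0 , αT≈αS) = compare (T.row zero ≟ₖ S.row zero)
          where
          y = T.factor-row₀ α
          y≈ : y ≈ₚ S.factor-row₀ α
          y≈ = P.+-congˡ {const (α zero)} (tabulate-cong λ j → sum-cong-≋ {k} λ i → F.*-congˡ {α (suc i)} (ratio≈ i j))
          r₀y≡s₀y : T.row zero *ₚ y ≡ₘ S.row zero *ₚ y
          r₀y≡s₀y = begin
            T.row zero *ₚ y                       ≈⟨ K.*-comm (T.row zero) y ⟩
            y *ₚ T.row zero                       ≈⟨ T.*ᵛ≡factor* α ⟨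
            tabulate (α *ᵛ T)                     ≈⟨ ≈⇒≡ₘ (tabulate-cong αT≈αS) ⟩
            tabulate (α *ᵛ S)                     ≈⟨ S.*ᵛ≡factor* α ⟩
            S.factor-row₀ α *ₚ S.row zero         ≈⟨ ≈⇒≡ₘ (P.*-congʳ {S.row zero} y≈) ⟨
            y *ₚ S.row zero                       ≈⟨ K.*-comm y (S.row zero) ⟩
            S.row zero *ₚ y                       ∎
          compare : Dec (T.row zero ≡ₘ S.row zero) → T ≈ᴹ S
          compare (yes r₀≡s₀) = same-ratios (tabulate-injective r₀≡s₀)
          compare (no r₀≢s₀)  = contradiction (ind α (tabulate≡0 (begin
            tabulate (α *ᵛ T)    ≈⟨ T.*ᵛ≡factor* α ⟩
            y *ₚ T.row zero      ≈⟨ ≡ₘ-*-cong (*-equalʳ⇒≈0 r₀≢s₀ r₀y≡s₀y) (K.refl {T.row zero}) ⟩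
            [] *ₚ T.row zero     ≡⟨⟩
            []                   ∎))) α≉0

      encodeRatios-injective : ∀ {N} {a b : Fin N} → (a ≡ b → T.minor ≈ᴹ S.minor) →
        T.encodeRatios a ≡ S.encodeRatios b → ∀ i → T.ratio i ≈ᵛ S.ratio i
      encodeRatios-injective a≡b⇒ eq i j =
        let head≡ , a≡b = Fin.combine-injective _ _ _ _ eq in
        by-column (encodeVector-injective head≡ i) (a≡b⇒ a≡b i) j
        where
        by-column : T.ratio i zero F.≈ S.ratio i zero → (∀ j → T.minor i j F.≈ S.minor i j) →
                    ∀ j → T.ratio i j F.≈ S.ratio i j
        by-column h t zero    = h
        by-column h t (suc j) = t j

  -- Expresses that at most `N` matrices are nonsingular. The code may depend on the proof of
  -- independence, so injectivity quantifies over both proofs.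
  record Encoding (n N : ℕ) : Set (c ⊔ ℓ) where
    field
      encode    : (T : Matrix n) → Independent T → Fin N
      injective : ∀ {T S} (indT : Independent T) (indS : Independent S) →
                  encode T indT ≡ encode S indS → T ≈ᴹ S

  -- Row 0 is nonzero, so deleting the code of the zero vector leaves q^(k + 1) - 1 values for it.
  -- The ratios take q^k N values through the minor, and together with row 0 they determine the
  -- matrix.
  encoding-suc : ∀ {k N p} → Irreducible (suc k) p → Encoding k N →
                 Encoding (suc k) ((q ℕ.^ suc k ℕ.∸ 1) ℕ.* (q ℕ.^ k ℕ.* N))
  encoding-suc {k} {N} irr enc = record
    { encode    = λ T ind → combine (row₀-code T ind) (ratio-code T ind)
    ; injective = λ {T} {S} → injective {T} {S}
    }
    where
    open RowQuotients irr
    module Enc = Encoding enc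
    0-code : Fin (q ℕ.^ suc k)
    0-code = encodeVector {suc k} 0ᵛ
    row₀≉0 : ∀ (T : Matrix (suc k)) → Independent T → ¬ T zero ≈ᵛ 0ᵛ
    row₀≉0 T ind = Independent⇒row≉0 {T = T} ind zero
    ≢0-code : ∀ (T : Matrix (suc k)) → Independent T → 0-code ≢ encodeVector (T zero)
    ≢0-code T ind eq = row₀≉0 T ind (λ j → F.sym (encodeVector-injective {v = 0ᵛ} {w = T zero} eq j))
    minor : ∀ (T : Matrix (suc k)) → Independent T → Matrix k
    minor T ind = Normalised.minor T (row₀≉0 T ind)
    minor-independent : ∀ (T : Matrix (suc k)) ind → Independent (minor T ind)
    minor-independent T ind = Normalised.minor-independent T (row₀≉0 T ind) ind
    row₀-code : ∀ (T : Matrix (suc k)) → Independent T → Fin (q ℕ.^ suc k ℕ.∸ 1)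
    row₀-code T ind = delete 0-code (encodeVector (T zero)) (≢0-code T ind)
    minor-code : ∀ (T : Matrix (suc k)) → Independent T → Fin N
    minor-code T ind = Enc.encode (minor T ind) (minor-independent T ind)
    ratio-code : ∀ (T : Matrix (suc k)) → Independent T → Fin (q ℕ.^ k ℕ.* N)
    ratio-code T ind = Normalised.encodeRatios T (row₀≉0 T ind) (minor-code T ind)
    injective : ∀ {T S : Matrix (suc k)} (indT : Independent T) (indS : Independent S) →
      combine (row₀-code T indT) (ratio-code T indT) ≡ combine (row₀-code S indS) (ratio-code S indS) →
      T ≈ᴹ S
    injective {T} {S} indT indS eq =
      same-ratios {T} {S} (row₀≉0 T indT) (row₀≉0 S indS)
        (encodeRatios-injective {T} {S} (row₀≉0 T indT) (row₀≉0 S indS)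
          {a = minor-code T indT} {b = minor-code S indS}
          (Enc.injective (minor-independent T indT) (minor-independent S indS))
          (Fin.combine-injectiveʳ (row₀-code T indT) (ratio-code T indT) (row₀-code S indS) (ratio-code S indS) eq))
        (encodeVector-injective {v = T zero} {w = S zero}
          (delete-injective 0-code (≢0-code T indT) (≢0-code S indS)
            (Fin.combine-injectiveˡ (row₀-code T indT) (ratio-code T indT) (row₀-code S indS) (ratio-code S indS) eq)))

  -- The recursion uses one irreducible polynomial of each degree from 1 to `k`. Each is available
  -- only under a double negation, which the conclusion inherits. At size 0 the empty matrix takes
  -- the single code.
  encoding-exists : ∀ k → ¬ ¬ Encoding k (encodingSize q k)
  encoding-exists zero    none = none (record { encode = λ _ _ → zero ; injective = λ _ _ _ () })
  encoding-exists (suc k) none = irreducible-exists (s≤s z≤n) λ (p , irr) →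
    encoding-exists k λ enc → none (encoding-suc irr enc)

-- Closed form of the bound, and its application to intersecting sets.

open import Data.Nat.Base using (_+_; _*_; _∸_; _^_; _/_; _≤_)

-- The numerators differ by twice `suc k`, a multiple of the divisor, so the floors differ by
-- exactly `suc k` and no parity argument arises.
triangular-suc : ∀ k → suc k * suc (suc k) / 2 ≡ suc k + k * suc k / 2
triangular-suc k = begin
  suc k * suc (suc k) / 2             ≡⟨ ≡.cong (_/ 2) (expand k) ⟩
  (k * suc k + suc k * 2) / 2         ≡⟨ +-distrib-/-∣ʳ (k * suc k) (divides-refl (suc k)) ⟩
  k * suc k / 2 + suc k * 2 / 2       ≡⟨ ≡.cong (k * suc k / 2 +_) (m*n/n≡m (suc k) 2) ⟩
  k * suc k / 2 + suc k               ≡⟨ ℕ.+-comm _ (suc k) ⟩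
  suc k + k * suc k / 2               ∎
  where
  open ≡-Reasoning
  expand : ∀ k → suc k * suc (suc k) ≡ k * suc k + suc k * 2
  expand = solve-∀

product-map-upTo-suc : ∀ (f : ℕ → ℕ) k →
  ListAction.product (map f (upTo (suc k))) ≡ ListAction.product (map f (upTo k)) * f k
product-map-upTo-suc f k = begin
  ListAction.product (map f (upTo (suc k)))             ≡⟨ ≡.cong (λ l → ListAction.product (map f l)) (List.upTo-∷ʳ k) ⟨
  ListAction.product (map f (upTo k ∷ʳ k))              ≡⟨ ≡.cong ListAction.product (List.map-++ f (upTo k) (k ∷ [])) ⟩
  ListAction.product (map f (upTo k) ++ f k ∷ [])       ≡⟨ ListAction.product-++ (map f (upTo k)) _ ⟩
  ListAction.product (map f (upTo k)) * (f k * 1)       ≡⟨ ≡.cong (ListAction.product (map f (upTo k)) *_) (ℕ.*-identityʳ (f k)) ⟩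
  ListAction.product (map f (upTo k)) * f k             ∎
  where open ≡-Reasoning

-- From `k` to `suc k` both sides gain the factor q^(k + 1) (q^(k + 1) - 1): the triangular exponent
-- grows by k + 1, and the product acquires its last factor.
q^k*encodingSize : ∀ q k → q ^ k * encodingSize q k ≡
  q ^ (k * suc k / 2) * ListAction.product (map (λ i → q ^ suc i ∸ 1) (upTo k))
q^k*encodingSize q zero    = ≡.refl
q^k*encodingSize q (suc k) = begin
  q ^ suc k * (u * (q ^ k * encodingSize q k))
    ≡⟨ ≡.cong (λ e → q ^ suc k * (u * e)) (q^k*encodingSize q k) ⟩
  q ^ suc k * (u * (q ^ (k * suc k / 2) * Π))
    ≡⟨ rearrange (q ^ suc k) u (q ^ (k * suc k / 2)) Π ⟩
  q ^ suc k * q ^ (k * suc k / 2) * (Π * u)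
    ≡⟨ ≡.cong₂ _*_ (ℕ.^-distribˡ-+-* q (suc k) (k * suc k / 2)) (product-map-upTo-suc _ k) ⟨
  q ^ (suc k + k * suc k / 2) * ListAction.product (map (λ i → q ^ suc i ∸ 1) (upTo (suc k)))
    ≡⟨ ≡.cong (λ e → q ^ e * ListAction.product (map (λ i → q ^ suc i ∸ 1) (upTo (suc k)))) (triangular-suc k) ⟨
  q ^ (suc k * suc (suc k) / 2) * ListAction.product (map (λ i → q ^ suc i ∸ 1) (upTo (suc k))) ∎
  where
  open ≡-Reasoning
  u = q ^ suc k ∸ 1
  Π = ListAction.product (map (λ i → q ^ suc i ∸ 1) (upTo k))
  rearrange : ∀ a b c d → a * (b * (c * d)) ≡ a * c * (d * b)
  rearrange = solve-∀

theorem2 : ∀ {c ℓ p : Level} (𝔽 : CommutativeRing c ℓ) → IsField 𝔽 →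
    let open LinearAlgebra 𝔽 in
    (q : ℕ) → CommutativeRing.setoid 𝔽 HasCardinality q →
    (n : ℕ) → 1 ≤ n →
    (𝓕 : Pred (Matrix n) p) → 𝓕 Respects _≈ᴹ_ → 𝓕 ⊆ GL n →
    Intersecting 𝓕 →
    (m : ℕ) → subset (matrixSetoid n) 𝓕 HasCardinality m →
    m ≤ q ^ ((n ∸ 1) * n / 2) * product (map (λ i → q ^ suc i ∸ 1) (upTo (n ∸ 1)))
theorem2 𝔽 isField q finite (suc k) 1≤n 𝓕 _ 𝓕⊆GL intersecting m enum =
  -- The inequality is decidable, so the polynomial and the encoding may be taken out of their
  -- double negations. The polynomial has degree n = k + 1, while the encoding is for the minors, of
  -- size k.
  ≡.subst (m ≤_) (q^k*encodingSize q k) (decidable-stable (m ℕ.≤? _) λ m≰ →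
    irreducible-exists 1≤n λ (p , irr) → encoding-exists k λ enc → m≰ (bound irr enc))
  where
  open Counting 𝔽 isField finite
  open IrreducibleExistence 𝔽 isField finite using (Irreducible; irreducible-exists)
  open LinearAlgebra 𝔽
  module 𝓕 = Bijection enum

  matrix : Fin m → Matrix (suc k)
  matrix i = proj₁ (𝓕.to i)

  independent : ∀ i → Independent (matrix i)
  independent i = GL⇒Independent {T = matrix i} (𝓕⊆GL (proj₂ (𝓕.to i)))

  row₀≉0 : ∀ i → ¬ matrix i zero ≈ᵛ 0ᵛ
  row₀≉0 i = Independent⇒row≉0 {T = matrix i} (independent i) zero

  bound : ∀ {p} → Irreducible (suc k) p → Encoding k (encodingSize q k) →
          m ≤ q ^ k * encodingSize q k
  -- The code records the ratios and omits row 0. Equal codes give equal ratios, and two members of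
  -- an intersecting set with equal ratios coincide.
  bound irr enc = Fin.injective⇒≤ {f = code} λ {i} {j} eq → 𝓕.injective
    (same-ratios-intersecting {matrix i} {matrix j} (row₀≉0 i) (row₀≉0 j)
      (encodeRatios-injective {matrix i} {matrix j} (row₀≉0 i) (row₀≉0 j)
        {a = minor-code i} {b = minor-code j}
        (Encoding.injective enc (minor-independent i) (minor-independent j)) eq)
      (independent i) (intersecting (proj₂ (𝓕.to i)) (proj₂ (𝓕.to j))))
    where
    open RowQuotients irr
    minor : ∀ i → Matrix k
    minor i = Normalised.minor (matrix i) (row₀≉0 i)
    minor-independent : ∀ i → Independent (minor i)
    minor-independent i = Normalised.minor-independent (matrix i) (row₀≉0 i) (independent i)
    minor-code : Fin m → Fin (encodingSize q k)
    minor-code i = Encoding.encode enc (minor i) (minor-independent i)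
    code : Fin m → Fin (q ^ k * encodingSize q k)
    code i = Normalised.encodeRatios (matrix i) (row₀≉0 i) (minor-code i)
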